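{- Let $p>3$ be a prime. For any $p$-adic integer $a$, we have $$\sum_{k=0}^{p-1}\binom{ -a}{k}\binom{a-1}{k}H_k\equiv(-1)^{\langle a\rangle_p-1}\,2\sum_{0<k<\langle a\rangle_p}\frac1{a-k}\pmod{p^2},$$ $$\sum_{k=0}^{p-1}\binom{ -a}{k}\binom{a-1}{k}H_k\equiv(-1)^{\langle a-1\rangle_p}\Bigl(2H_{\langle a-1\rangle_p}+(a-\langle a\rangle_p)B_{p-2}(a)\Bigr)\pmod{p^2},$$ and $$\sum_{k=0}^{p-1}\binom{ -a}{k}\binom{a-1}{k}H_k\equiv(-1)^{\langle a\rangle_p}\,2\bigl(B_{p-1}(a)-B_{p-1}\bigr)\pmod{p}.$$
   Context: For $n\in\mathbb N=\{0,1,2,\ldots\}$, $H_n=\sum_{0<k\le n}\frac1k$ is the harmonic number (so $H_0=0$). For a prime $p$ and a $p$-adic integer $a$, $\langle a\rangle_p$ denotes the unique integer $r\in\{0,1,\ldots,p-1\}$ with $a\equiv r\pmod p$. $B_0,B_1,B_2,\ldots$ are the Bernoulli numbers (with $B_1=-\frac12$), and $B_n(x)=\sum_{k=0}^n\binom nk B_kx^{n-k}$ is the Bernoulli polynomial of degree $n$. $\binom{x}{k}=\frac{x(x-1)\cdots(x-k+1)}{k!}$ is the generalized binomial coefficient. Congruences modulo $p^j$ are congruences in the ring $\mathbb Z_p$ of $p$-adic integers. Empty sums are $0$. -}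

module Defs where

open import Algebra.Bundles.Raw using (RawRing)
import Algebra.Definitions.RawMonoid as RawMonoidDefinitions
import Algebra.Definitions.RawSemiring as RawSemiringDefinitions
open import Data.Fin.Base using (toℕ)
open import Data.Fin.Properties using (toℕ<n)
open import Data.Integer.Base as ℤ using (ℤ; +_; 0ℤ; 1ℤ)
open import Data.Integer.Divisibility.Signed
  using (_∣_; divides; ∣ᵤ⇒∣; ∣⇒∣ᵤ; ∣-trans; ∣m∣n⇒∣m+n; ∣m∣n⇒∣m-n; ∣m⇒∣-m; ∣n⇒∣m*n; ∣m⇒∣m*n)
open import Data.Integer.DivMod using (_%ℕ_; _/ℕ_; n%ℕd<d; a≡a%ℕn+[a/ℕn]*n)
import Data.Integer.Properties as ℤ
open import Data.Integer.Tactic.RingSolver using (solve-∀)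
open import Data.Nat.Base as ℕ using (ℕ; zero; suc; _∸_; _<_; s≤s; z≤n; _!)
open import Data.Nat.Combinatorics using (_C_)
import Data.Nat.Divisibility as ℕ
open import Data.Nat.Induction using (<-rec)
open import Data.Nat.Primality
  using (Prime; euclidsLemma; prime⇒nonZero; prime⇒nonTrivial)
import Data.Nat.Properties as ℕ
open import Data.Product.Base using (Σ; ∃; _×_; _,_)
open import Data.Rational.Base as ℚ using (ℚ; ↥_; ↧_; ↧ₙ_)
open import Data.Sum.Base using (_⊎_; inj₁; inj₂; map₁; map₂)
open import Level using (0ℓ)
open import Relation.Binary.PropositionalEquality
  using (_≡_; refl; sym; trans; cong; subst; subst₂)
open import Relation.Nullary.Negation using (¬_)

------------------------------------------------------------------------
-- Harmonic and Bernoulli numbers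

private
  module ℚ-Sum = RawMonoidDefinitions ℚ.+-0-rawMonoid

H : ℕ → ℚ
H n = ℚ-Sum.sum {n} (λ i → 1ℤ ℚ./ suc (toℕ i))

-- B₀ = 1 and ∑_{k ≤ n} C(n+1,k) Bₖ = 0 for n ≥ 1, solved for Bₙ.
B-step : ∀ n → (∀ {k} → k < n → ℚ) → ℚ
B-step zero      _   = ℚ.1ℚ
B-step n@(suc _) rec = ℚ.- (1ℤ ℚ./ suc n) ℚ.*
  ℚ-Sum.sum {n} (λ i → (+ (suc n C toℕ i) ℚ./ 1) ℚ.* rec (toℕ<n i))

B : ℕ → ℚ
B = <-rec (λ _ → ℚ) B-step

private
  _ : B 1 ≡ ℚ.- ℚ.½
  _ = refl

  _ : B 4 ≡ ℚ.- (1ℤ ℚ./ 30)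
  _ = refl

------------------------------------------------------------------------
-- p-adic numbers

module Padic (p : ℕ) (p-prime : Prime p) where

  private
    instance
      p≢0 : ℕ.NonZero p
      p≢0 = prime⇒nonZero p-prime

  p^ : ℕ → ℤ
  p^ n = + (p ℕ.^ n)

  -- ℤₚ is the inverse limit of the rings ℤ/pⁿℤ: `x at n` is any integer
  -- representing x modulo pⁿ, so equality of p-adic integers is _≈ᶻ_.
  record ℤₚ : Set where
    constructor mkℤₚ
    infix 9 _at_
    field
      _at_     : ℕ → ℤ
      coherent : ∀ n → p^ n ∣ _at_ (suc n) ℤ.- _at_ n

  open ℤₚ public

  infix  4 _≈ᶻ_ _≡_modᶻ-p^_
  infixl 6 _+ᶻ_ _-ᶻ_
  infixl 7 _*ᶻ_
  infix  8 -ᶻ_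

  _≈ᶻ_ : ℤₚ → ℤₚ → Set
  x ≈ᶻ y = ∀ n → p^ n ∣ x at n ℤ.- y at n

  fromℤ : ℤ → ℤₚ
  fromℤ i at n = i
  coherent (fromℤ i) n = divides 0ℤ (ℤ.+-inverseʳ i)

  0ᶻ 1ᶻ : ℤₚ
  0ᶻ = fromℤ 0ℤ
  1ᶻ = fromℤ 1ℤ

  _+ᶻ_ : ℤₚ → ℤₚ → ℤₚ
  (x +ᶻ y) at n = x at n ℤ.+ y at n
  coherent (x +ᶻ y) n = subst (p^ n ∣_) (lemma (x at suc n) (x at n) (y at suc n) (y at n))
    (∣m∣n⇒∣m+n (coherent x n) (coherent y n))
    where
    lemma : ∀ a b c d → (a ℤ.- b) ℤ.+ (c ℤ.- d) ≡ (a ℤ.+ c) ℤ.- (b ℤ.+ d)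
    lemma = solve-∀

  -ᶻ_ : ℤₚ → ℤₚ
  (-ᶻ x) at n = ℤ.- (x at n)
  coherent (-ᶻ x) n = subst (p^ n ∣_) (lemma (x at suc n) (x at n)) (∣m⇒∣-m (coherent x n))
    where
    lemma : ∀ a b → ℤ.- (a ℤ.- b) ≡ ℤ.- a ℤ.- ℤ.- b
    lemma = solve-∀

  _-ᶻ_ : ℤₚ → ℤₚ → ℤₚ
  x -ᶻ y = x +ᶻ (-ᶻ y)

  _*ᶻ_ : ℤₚ → ℤₚ → ℤₚ
  (x *ᶻ y) at n = x at n ℤ.* y at n
  coherent (x *ᶻ y) n = subst (p^ n ∣_) (lemma (x at suc n) (x at n) (y at suc n) (y at n))
    (∣m∣n⇒∣m+n (∣n⇒∣m*n (x at suc n) (coherent y n)) (∣m⇒∣m*n (y at n) (coherent x n)))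
    where
    lemma : ∀ a b c d → a ℤ.* (c ℤ.- d) ℤ.+ (a ℤ.- b) ℤ.* d ≡ a ℤ.* c ℤ.- b ℤ.* d
    lemma = solve-∀

  ℤₚ-rawRing : RawRing 0ℓ 0ℓ
  ℤₚ-rawRing = record
    { Carrier = ℤₚ ; _≈_ = _≈ᶻ_ ; _+_ = _+ᶻ_ ; _*_ = _*ᶻ_ ; -_ = -ᶻ_ ; 0# = 0ᶻ ; 1# = 1ᶻ }

  _≡_modᶻ-p^_ : ℤₚ → ℤₚ → ℕ → Set
  x ≡ y modᶻ-p^ j = ∃ λ z → x ≈ᶻ y +ᶻ fromℤ (p^ j) *ᶻ z

  ⟨_⟩ : ℤₚ → ℕ
  ⟨ x ⟩ = x at 1 %ℕ p

  -- Being nonzero, in the positive (apartness) form.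
  _#0 : ℤₚ → Set
  x #0 = ∃ λ n → ¬ p^ n ∣ x at n

  private
    coherent-+ : ∀ x m n → p^ n ∣ x at (m ℕ.+ n) ℤ.- x at n
    coherent-+ x zero    n = divides 0ℤ (ℤ.+-inverseʳ (x at n))
    coherent-+ x (suc m) n = subst (p^ n ∣_) (lemma (x at suc (m ℕ.+ n)) (x at (m ℕ.+ n)) (x at n))
      (∣m∣n⇒∣m+n
        (∣-trans (∣ᵤ⇒∣ (ℕ.divides (p ℕ.^ m) (ℕ.^-distribˡ-+-* p m n))) (coherent x (m ℕ.+ n)))
        (coherent-+ x m n))
      where
      lemma : ∀ a b c → (a ℤ.- b) ℤ.+ (b ℤ.- c) ≡ a ℤ.- c
      lemma = solve-∀

    ∣-at-+ : ∀ x m n → p^ n ∣ x at (m ℕ.+ n) → p^ n ∣ x at n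
    ∣-at-+ x m n d = subst (p^ n ∣_) (lemma (x at (m ℕ.+ n)) (x at n))
      (∣m∣n⇒∣m-n d (coherent-+ x m n))
      where
      lemma : ∀ a b → a ℤ.- (a ℤ.- b) ≡ b
      lemma = solve-∀

    p^-split : ∀ m n a b → p ℕ.^ (m ℕ.+ n) ℕ.∣ a ℕ.* b → p ℕ.^ m ℕ.∣ a ⊎ p ℕ.^ n ℕ.∣ b
    p^-split zero    n       a b _ = inj₁ (ℕ.1∣ a)
    p^-split (suc m) zero    a b _ = inj₂ (ℕ.1∣ b)
    p^-split (suc m) (suc n) a b d
      with euclidsLemma a b p-prime (ℕ.∣-trans (ℕ.m∣m*n (p ℕ.^ (m ℕ.+ suc n))) d)
    ... | inj₁ (ℕ.divides q refl) = map₁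
      (λ e → subst (p ℕ.^ suc m ℕ.∣_) (ℕ.*-comm p q) (ℕ.*-monoʳ-∣ p e))
      (p^-split m (suc n) q b (ℕ.*-cancelˡ-∣ p (subst (p ℕ.^ (suc m ℕ.+ suc n) ℕ.∣_) eq d)))
      where
      eq : q ℕ.* p ℕ.* b ≡ p ℕ.* (q ℕ.* b)
      eq = trans (cong (ℕ._* b) (ℕ.*-comm q p)) (ℕ.*-assoc p q b)
    ... | inj₂ (ℕ.divides q refl) = map₂
      (λ e → subst (p ℕ.^ suc n ℕ.∣_) (ℕ.*-comm p q) (ℕ.*-monoʳ-∣ p e))
      (p^-split (suc m) n a q
        (subst (λ k → p ℕ.^ k ℕ.∣ a ℕ.* q) (ℕ.+-suc m n)
          (ℕ.*-cancelˡ-∣ p (subst (p ℕ.^ (suc m ℕ.+ suc n) ℕ.∣_) eq d))))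
      where
      eq : a ℕ.* (q ℕ.* p) ≡ p ℕ.* (a ℕ.* q)
      eq = trans (sym (ℕ.*-assoc a q p)) (ℕ.*-comm (a ℕ.* q) p)

    n<p^n : ∀ n → n < p ℕ.^ n
    n<p^n zero    = s≤s z≤n
    n<p^n (suc n) = ℕ.<-≤-trans (s≤s (n<p^n n))
      (subst (suc (p ℕ.^ n) ℕ.≤_) (ℕ.*-comm (p ℕ.^ n) p)
        (ℕ.m<m*n (p ℕ.^ n) p (ℕ.nonTrivial⇒n>1 p)))
      where
      instance
        _ = prime⇒nonTrivial p-prime
        _ = ℕ.m^n≢0 p n

  *-#0 : ∀ {x y} → x #0 → y #0 → (x *ᶻ y) #0
  *-#0 {x} {y} (m , ¬x) (n , ¬y) = m ℕ.+ n , λ d →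
    split (p^-split m n _ _ (subst (p ℕ.^ (m ℕ.+ n) ℕ.∣_) (ℤ.abs-* (x at (m ℕ.+ n)) _) (∣⇒∣ᵤ d)))
    where
    split : ¬ (p ℕ.^ m ℕ.∣ ℤ.∣ x at (m ℕ.+ n) ∣ ⊎ p ℕ.^ n ℕ.∣ ℤ.∣ y at (m ℕ.+ n) ∣)
    split (inj₁ d) = ¬x (∣-at-+ x n m (subst (λ k → p^ m ∣ x at k) (ℕ.+-comm m n) (∣ᵤ⇒∣ d)))
    split (inj₂ d) = ¬y (∣-at-+ y m n (∣ᵤ⇒∣ d))

  fromℕ-#0 : ∀ n .{{_ : ℕ.NonZero n}} → fromℤ (+ n) #0
  fromℕ-#0 n = n , λ d → ℕ.<⇒≱ (n<p^n n) (ℕ.∣⇒≤ (∣⇒∣ᵤ d))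

  -- a - k is nonzero even modulo p when k < ⟨ a ⟩.
  shift-#0 : ∀ a {k} → k < ⟨ a ⟩ → (a -ᶻ fromℤ (+ k)) #0
  shift-#0 a {k} k<r = 1 , λ d → ℕ.<⇒≱ r∸k<p
    (ℕ.∣⇒≤ {{ℕ.>-nonZero (ℕ.m<n⇒0<n∸m k<r)}} (p∣r∸k d))
    where
    r : ℕ
    r = ⟨ a ⟩

    r∸k<p : r ∸ k < p
    r∸k<p = ℕ.≤-<-trans (ℕ.m∸n≤m r k) (n%ℕd<d (a at 1) p)

    lemma : ∀ r k q → (r ℤ.+ q ℤ.- k) ℤ.- q ≡ r ℤ.- k
    lemma = solve-∀

    p∣r∸k : p^ 1 ∣ a at 1 ℤ.- + k → p ℕ.∣ r ∸ k
    p∣r∸k d = ∣⇒∣ᵤ (subst (+ p ∣_) eq (∣m∣n⇒∣m-n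
      (subst₂ _∣_ (cong +_ (ℕ.^-identityʳ p))
        (cong (ℤ._- + k) (a≡a%ℕn+[a/ℕn]*n (a at 1) p)) d)
      (divides (a at 1 /ℕ p) refl)))
      where
      eq : (+ r ℤ.+ (a at 1 /ℕ p) ℤ.* + p ℤ.- + k) ℤ.- (a at 1 /ℕ p) ℤ.* + p ≡ + (r ∸ k)
      eq = trans (lemma (+ r) (+ k) ((a at 1 /ℕ p) ℤ.* + p)) (trans (ℤ.m-n≡m⊖n r k) (ℤ.⊖-≥ (ℕ.<⇒≤ k<r)))

  -- ℚₚ is the field of fractions of ℤₚ, with equality _≈_.
  record ℚₚ : Set where
    constructor mkℚₚ
    field
      num    : ℤₚ
      den    : ℤₚ
      den-#0 : den #0

  open ℚₚ public

  infix  4 _≈_ _≡_mod-p^_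
  infixl 6 _+_ _-_
  infixl 7 _*_
  infix  8 -_

  _≈_ : ℚₚ → ℚₚ → Set
  x ≈ y = num x *ᶻ den y ≈ᶻ num y *ᶻ den x

  ι : ℤₚ → ℚₚ
  ι x = mkℚₚ x 1ᶻ (fromℕ-#0 1)

  fromℚ : ℚ → ℚₚ
  fromℚ q = mkℚₚ (fromℤ (↥ q)) (fromℤ (↧ q)) (fromℕ-#0 (↧ₙ q))

  1/ : (x : ℤₚ) → x #0 → ℚₚ
  1/ x x#0 = mkℚₚ 1ᶻ x x#0

  _+_ : ℚₚ → ℚₚ → ℚₚ
  x + y = mkℚₚ (num x *ᶻ den y +ᶻ num y *ᶻ den x) (den x *ᶻ den y)
               (*-#0 {den x} {den y} (den-#0 x) (den-#0 y))

  _*_ : ℚₚ → ℚₚ → ℚₚ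
  x * y = mkℚₚ (num x *ᶻ num y) (den x *ᶻ den y) (*-#0 {den x} {den y} (den-#0 x) (den-#0 y))

  -_ : ℚₚ → ℚₚ
  - x = mkℚₚ (-ᶻ num x) (den x) (den-#0 x)

  _-_ : ℚₚ → ℚₚ → ℚₚ
  x - y = x + (- y)

  ℚₚ-rawRing : RawRing 0ℓ 0ℓ
  ℚₚ-rawRing = record
    { Carrier = ℚₚ ; _≈_ = _≈_ ; _+_ = _+_ ; _*_ = _*_ ; -_ = -_ ; 0# = ι 0ᶻ ; 1# = ι 1ᶻ }

  open RawSemiringDefinitions (RawRing.rawSemiring ℚₚ-rawRing) public
    using (sum; product; _^_)

  -- Both sides lie in the subring ℤₚ, and are congruent modulo pʲ there.
  _≡_mod-p^_ : ℚₚ → ℚₚ → ℕ → Set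
  x ≡ y mod-p^ j = Σ (ℤₚ × ℤₚ) λ (u , v) → x ≈ ι u × y ≈ ι v × u ≡ v modᶻ-p^ j

  sum-< : ℕ → (ℕ → ℚₚ) → ℚₚ
  sum-< n f = sum {n} (λ i → f (toℕ i))

  infixr 5 sum-< sum-0<
  syntax sum-< n (λ k → x) = ∑[ k < n ] x

  -- ∑ over 0 < k < n; the summand may use that k < n.
  sum-0< : (n : ℕ) → (∀ k → k < n → ℚₚ) → ℚₚ
  sum-0< zero    f = ι 0ᶻ
  sum-0< (suc n) f = sum {n} (λ i → f (suc (toℕ i)) (s≤s (toℕ<n i)))

  syntax sum-0< n (λ k k<n → x) = ∑[0< k < n by k<n ] x

  2ₚ : ℚₚ
  2ₚ = ι (fromℤ (+ 2))

  binom : ℚₚ → ℕ → ℚₚ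
  binom x k = product {k} (λ i → x - ι (fromℤ (+ toℕ i))) * fromℚ (recip-! k)
    where
    recip-! : ℕ → ℚ
    recip-! n = (1ℤ ℚ./ (n !)) {{n ℕ.!≢0}}

  -- (-1)^m for m ∈ ℤ, where (-1)^(-n) = (-1)^n.
  -1^_ : ℤ → ℚₚ
  -1^ m = (- ι 1ᶻ) ^ ℤ.∣ m ∣

  -- The value Bₙ(x) of the Bernoulli polynomial.
  Bₚ : ℕ → ℚₚ → ℚₚ
  Bₚ n x = ∑[ k < suc n ] fromℚ ((+ (n C k) ℚ./ 1) ℚ.* B k) * x ^ (n ∸ k)

{-# OPTIONS --safe #-}

module Submission where

-- Write wₖ(x) = C(-1-x,k) C(x,k), so that the left-hand side is S(x) = ∑_{k<p} wₖ(x) Hₖ at x = a - 1.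
-- Summation by parts and a second telescoping sum in x give S(n) = (-1)ⁿ 2 Hₙ for 0 ≤ n < p.
-- Write a - 1 = s + tp with 0 ≤ s < p.  A polynomial with p-integral coefficients is affine modulo p²
-- along s + pℤ, and S(x) = S(-1-x), so S(s + tp) ≡ (1 + t) S(s) - t S(p-1-s) (mod p²).  Since
-- H_{p-1-s} ≡ H_{p-1} + Hₛ + p Hₛ⁽²⁾ (mod p²) and H_{p-1} ≡ 0 (mod p²) by Wolstenholme, this yields
--   S(a - 1) ≡ (-1)ˢ 2 (Hₛ - tp Hₛ⁽²⁾) (mod p²),
-- which is the first congruence.  The other two follow because Bₙ(x+1) - Bₙ(x) = n xⁿ⁻¹ and Fermat's
-- little theorem give B_{p-2}(a) ≡ -2 Hₛ⁽²⁾ and B_{p-1}(a) - B_{p-1} ≡ -Hₛ (mod p).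

open import Defs
open import Algebra.Bundles.Raw using (RawMonoid; RawRing)
import Algebra.Definitions.RawMonoid as RawMonoidDefinitions
open import Data.Empty using (⊥-elim)
open import Data.Fin.Base using (Fin; zero; suc; toℕ)
open import Data.Fin.Properties using (toℕ<n)
open import Data.Integer.Base as ℤ using (ℤ; +_; 0ℤ; 1ℤ)
open import Data.Integer.Divisibility.Signed
open import Data.Integer.DivMod using (_%ℕ_; _/ℕ_; n%ℕd<d; a≡a%ℕn+[a/ℕn]*n)
open import Data.Integer.GCD using (gcd)
import Data.Integer.Properties as ℤ
open import Data.Integer.Tactic.RingSolver using (solve-∀)
open import Data.Nat.Base as ℕ using (ℕ; zero; suc; _∸_; _<_; _≤_; s≤s; z≤n; _!)
open import Data.Nat.Combinatorics
  using (_C_; nCk+nC[k+1]≡[n+1]C[k+1]; k>n⇒nCk≡0; nCn≡1; nC1≡n; nCk≡nC[n∸k]; nCk≡n!/k![n-k]!; k![n∸k]!∣n!)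
import Data.Nat.Divisibility as ℕ
import Data.Nat.DivMod as ℕ
open import Data.Nat.Induction using (<-rec; <-wellFounded)
open import Data.Nat.Primality
  using (Prime; euclidsLemma; prime⇒nonZero; prime⇒nonTrivial; prime⇒irreducible)
import Data.Nat.Properties as ℕ
open import Data.Product.Base using (Σ; ∃; _×_; _,_; proj₁; proj₂)
open import Data.Rational.Base as ℚ using (ℚ; ↥_; ↧_; ↧ₙ_)
import Data.Rational.Properties as ℚ
open import Data.Sum.Base using (_⊎_; inj₁; inj₂; [_,_]′)
open import Function.Base using (_∘_)
import Induction.WellFounded as WellFounded
open import Level using (0ℓ)
open import Relation.Binary.Bundles using (Setoid)
open import Relation.Binary.PropositionalEquality
  using (_≡_; refl; sym; trans; cong; cong₂; subst; subst₂; module ≡-Reasoning)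
import Relation.Binary.Reasoning.Setoid as SetoidReasoning
open import Relation.Nullary.Decidable using (Dec; yes; no)
open import Relation.Nullary.Negation using (¬_)

infix 4 _≡_mod_

record _≡_mod_ (x y m : ℤ) : Set where
  constructor ∣⇒mod
  field divisible : m ∣ x ℤ.- y

open _≡_mod_

module _ {m : ℤ} where

  mod-reflexive : ∀ {x y} → x ≡ y → x ≡ y mod m
  mod-reflexive {x} refl = ∣⇒mod (divides 0ℤ (ℤ.+-inverseʳ x))

  mod-refl : ∀ {x} → x ≡ x mod m
  mod-refl = mod-reflexive refl

  linear₁ : ∀ {x y l r} c → l ≡ r mod m → x ℤ.- y ≡ c ℤ.* (l ℤ.- r) → x ≡ y mod m
  linear₁ c (∣⇒mod d) eq = ∣⇒mod (subst (m ∣_) (sym eq) (∣n⇒∣m*n c d))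

  linear₂ : ∀ {x y l r l′ r′} c c′ → l ≡ r mod m → l′ ≡ r′ mod m →
            x ℤ.- y ≡ c ℤ.* (l ℤ.- r) ℤ.+ c′ ℤ.* (l′ ℤ.- r′) → x ≡ y mod m
  linear₂ c c′ (∣⇒mod d) (∣⇒mod d′) eq =
    ∣⇒mod (subst (m ∣_) (sym eq) (∣m∣n⇒∣m+n (∣n⇒∣m*n c d) (∣n⇒∣m*n c′ d′)))

  linear₃ : ∀ {x y l r l′ r′ l″ r″} c c′ c″ → l ≡ r mod m → l′ ≡ r′ mod m → l″ ≡ r″ mod m →
            x ℤ.- y ≡ c ℤ.* (l ℤ.- r) ℤ.+ c′ ℤ.* (l′ ℤ.- r′) ℤ.+ c″ ℤ.* (l″ ℤ.- r″) → x ≡ y mod m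
  linear₃ c c′ c″ (∣⇒mod d) (∣⇒mod d′) (∣⇒mod d″) eq =
    ∣⇒mod (subst (m ∣_) (sym eq) (∣m∣n⇒∣m+n (∣m∣n⇒∣m+n (∣n⇒∣m*n c d) (∣n⇒∣m*n c′ d′)) (∣n⇒∣m*n c″ d″)))

  mod-sym : ∀ {x y} → x ≡ y mod m → y ≡ x mod m
  mod-sym {x} {y} e = linear₁ (ℤ.- 1ℤ) e (lemma x y)
    where
    lemma : ∀ x y → y ℤ.- x ≡ ℤ.- 1ℤ ℤ.* (x ℤ.- y)
    lemma = solve-∀

  mod-trans : ∀ {x y z} → x ≡ y mod m → y ≡ z mod m → x ≡ z mod m
  mod-trans {x} {y} {z} e f = linear₂ 1ℤ 1ℤ e f (lemma x y z)
    where
    lemma : ∀ x y z → x ℤ.- z ≡ 1ℤ ℤ.* (x ℤ.- y) ℤ.+ 1ℤ ℤ.* (y ℤ.- z)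
    lemma = solve-∀

  +-mod : ∀ {x y u v} → x ≡ y mod m → u ≡ v mod m → x ℤ.+ u ≡ y ℤ.+ v mod m
  +-mod {x} {y} {u} {v} e f = linear₂ 1ℤ 1ℤ e f (lemma x y u v)
    where
    lemma : ∀ x y u v → (x ℤ.+ u) ℤ.- (y ℤ.+ v) ≡ 1ℤ ℤ.* (x ℤ.- y) ℤ.+ 1ℤ ℤ.* (u ℤ.- v)
    lemma = solve-∀

  *-mod : ∀ {x y u v} → x ≡ y mod m → u ≡ v mod m → x ℤ.* u ≡ y ℤ.* v mod m
  *-mod {x} {y} {u} {v} e f = linear₂ u y e f (lemma x y u v)
    where
    lemma : ∀ x y u v → x ℤ.* u ℤ.- y ℤ.* v ≡ u ℤ.* (x ℤ.- y) ℤ.+ y ℤ.* (u ℤ.- v)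
    lemma = solve-∀

  neg-mod : ∀ {x y} → x ≡ y mod m → ℤ.- x ≡ ℤ.- y mod m
  neg-mod {x} {y} e = linear₁ (ℤ.- 1ℤ) e (lemma x y)
    where
    lemma : ∀ x y → ℤ.- x ℤ.- ℤ.- y ≡ ℤ.- 1ℤ ℤ.* (x ℤ.- y)
    lemma = solve-∀

  ∣⇒≡0 : ∀ {x} → m ∣ x → x ≡ 0ℤ mod m
  ∣⇒≡0 {x} d = ∣⇒mod (subst (m ∣_) (sym (ℤ.+-identityʳ x)) d)

  *-cancel-unit : ∀ {u u′ x} → u ℤ.* u′ ≡ 1ℤ mod m → u ℤ.* x ≡ 0ℤ mod m → x ≡ 0ℤ mod m
  *-cancel-unit {u} {u′} {x} e f = linear₂ (ℤ.- x) u′ e f (lemma u u′ x)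
    where
    lemma : ∀ u u′ x → x ℤ.- 0ℤ ≡ ℤ.- x ℤ.* (u ℤ.* u′ ℤ.- 1ℤ) ℤ.+ u′ ℤ.* (u ℤ.* x ℤ.- 0ℤ)
    lemma = solve-∀

  inverse-unique : ∀ {u x y} → u ℤ.* x ≡ 1ℤ mod m → u ℤ.* y ≡ 1ℤ mod m → x ≡ y mod m
  inverse-unique {u} {x} {y} e f = linear₂ y (ℤ.- x) e f (lemma u x y)
    where
    lemma : ∀ u x y → x ℤ.- y ≡ y ℤ.* (u ℤ.* x ℤ.- 1ℤ) ℤ.+ ℤ.- x ℤ.* (u ℤ.* y ℤ.- 1ℤ)
    lemma = solve-∀

mod-weaken : ∀ {m n x y} → m ∣ n → x ≡ y mod n → x ≡ y mod m
mod-weaken d (∣⇒mod e) = ∣⇒mod (∣-trans d e)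

mod-setoid : ℤ → Setoid _ _
mod-setoid m = record
  { Carrier = ℤ
  ; _≈_ = λ x y → x ≡ y mod m
  ; isEquivalence = record { refl = mod-refl ; sym = mod-sym ; trans = mod-trans }
  }

module ≡-mod-Reasoning m = SetoidReasoning (mod-setoid m)

∑ : ℕ → (ℕ → ℤ) → ℤ
∑ zero    f = 0ℤ
∑ (suc n) f = ∑ n f ℤ.+ f n

∑-front : ∀ n f → ∑ (suc n) f ≡ f 0 ℤ.+ ∑ n (λ k → f (suc k))
∑-front zero    f = ℤ.+-comm 0ℤ (f 0)
∑-front (suc n) f = trans (cong (ℤ._+ f (suc n)) (∑-front n f))
  (ℤ.+-assoc (f 0) (∑ n (λ k → f (suc k))) (f (suc n)))

∑-cong : ∀ {m} n {f g} → (∀ {k} → k < n → f k ≡ g k mod m) → ∑ n f ≡ ∑ n g mod m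
∑-cong zero    e = mod-refl
∑-cong (suc n) e = +-mod (∑-cong n (λ k<n → e (ℕ.m<n⇒m<1+n k<n))) (e ℕ.≤-refl)

sgn : ℕ → ℤ
sgn zero    = 1ℤ
sgn (suc n) = ℤ.- sgn n

-- Harmonic sums and the exact evaluation of S at natural numbers

-- inv k plays the role of 1/(k+1).
module Harmonic (inv : ℕ → ℤ) where

  h h₂ : ℕ → ℤ
  h  n = ∑ n inv
  h₂ n = ∑ n (λ k → inv k ℤ.* inv k)

  -- w x k = C(-1-x,k) C(x,k)
  w : ℤ → ℕ → ℤ
  w x zero    = 1ℤ
  w x (suc k) = w x k ℤ.* (+ k ℤ.* + suc k ℤ.- x ℤ.* (1ℤ ℤ.+ x)) ℤ.* (inv k ℤ.* inv k)

  W : ℤ → ℕ → ℤ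
  W x zero    = 1ℤ
  W x (suc k) = W x k ℤ.* (1ℤ ℤ.- (x ℤ.* inv k) ℤ.* (x ℤ.* inv k))

  P : ℤ → ℕ → ℤ
  P x n = ∑ n (λ k → W x k ℤ.* inv k)

  S : ℕ → ℤ → ℤ
  S n x = ∑ n (λ k → w x k ℤ.* h k)

  module Recurrences (m : ℤ) (N : ℕ) (inv-law : ∀ {k} → k < N → + suc k ℤ.* inv k ≡ 1ℤ mod m) where

    open ≡-mod-Reasoning m

    W-w : ∀ x k → k ≤ N → x ℤ.* W x k ≡ (x ℤ.- + k) ℤ.* w x k mod m
    W-w x zero    _   = mod-reflexive (lemma x)
      where
      lemma : ∀ x → x ℤ.* 1ℤ ≡ (x ℤ.- + 0) ℤ.* 1ℤ
      lemma = solve-∀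
    W-w x (suc k) k<N = linear₂ (1ℤ ℤ.- (x ℤ.* inv k) ℤ.* (x ℤ.* inv k))
      (ℤ.- (x ℤ.- + k) ℤ.* w x k ℤ.* (+ suc k ℤ.* inv k ℤ.+ 1ℤ))
      (W-w x k (ℕ.<⇒≤ k<N)) (inv-law k<N) (lemma x (+ k) (inv k) (W x k) (w x k))
      where
      lemma : ∀ x k i u v →
        x ℤ.* (u ℤ.* (1ℤ ℤ.- (x ℤ.* i) ℤ.* (x ℤ.* i)))
          ℤ.- (x ℤ.- (1ℤ ℤ.+ k)) ℤ.* (v ℤ.* (k ℤ.* (1ℤ ℤ.+ k) ℤ.- x ℤ.* (1ℤ ℤ.+ x)) ℤ.* (i ℤ.* i))
        ≡ (1ℤ ℤ.- (x ℤ.* i) ℤ.* (x ℤ.* i)) ℤ.* (x ℤ.* u ℤ.- (x ℤ.- k) ℤ.* v)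
          ℤ.+ (ℤ.- (x ℤ.- k) ℤ.* v ℤ.* ((1ℤ ℤ.+ k) ℤ.* i ℤ.+ 1ℤ)) ℤ.* ((1ℤ ℤ.+ k) ℤ.* i ℤ.- 1ℤ)
      lemma = solve-∀

    W-w′ : ∀ x k → k ≤ N → (1ℤ ℤ.+ x) ℤ.* W (1ℤ ℤ.+ x) k ≡ (1ℤ ℤ.+ x ℤ.+ + k) ℤ.* w x k mod m
    W-w′ x zero    _   = mod-reflexive (lemma x)
      where
      lemma : ∀ x → (1ℤ ℤ.+ x) ℤ.* 1ℤ ≡ (1ℤ ℤ.+ x ℤ.+ + 0) ℤ.* 1ℤ
      lemma = solve-∀
    W-w′ x (suc k) k<N = linear₂ (1ℤ ℤ.- ((1ℤ ℤ.+ x) ℤ.* inv k) ℤ.* ((1ℤ ℤ.+ x) ℤ.* inv k))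
      (ℤ.- (1ℤ ℤ.+ x ℤ.+ + k) ℤ.* w x k ℤ.* (+ suc k ℤ.* inv k ℤ.+ 1ℤ))
      (W-w′ x k (ℕ.<⇒≤ k<N)) (inv-law k<N) (lemma x (+ k) (inv k) (W (1ℤ ℤ.+ x) k) (w x k))
      where
      lemma : ∀ x k i u v →
        (1ℤ ℤ.+ x) ℤ.* (u ℤ.* (1ℤ ℤ.- ((1ℤ ℤ.+ x) ℤ.* i) ℤ.* ((1ℤ ℤ.+ x) ℤ.* i)))
          ℤ.- (1ℤ ℤ.+ x ℤ.+ (1ℤ ℤ.+ k)) ℤ.* (v ℤ.* (k ℤ.* (1ℤ ℤ.+ k) ℤ.- x ℤ.* (1ℤ ℤ.+ x)) ℤ.* (i ℤ.* i))
        ≡ (1ℤ ℤ.- ((1ℤ ℤ.+ x) ℤ.* i) ℤ.* ((1ℤ ℤ.+ x) ℤ.* i)) ℤ.* ((1ℤ ℤ.+ x) ℤ.* u ℤ.- (1ℤ ℤ.+ x ℤ.+ k) ℤ.* v)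
          ℤ.+ (ℤ.- (1ℤ ℤ.+ x ℤ.+ k) ℤ.* v ℤ.* ((1ℤ ℤ.+ k) ℤ.* i ℤ.+ 1ℤ)) ℤ.* ((1ℤ ℤ.+ k) ℤ.* i ℤ.- 1ℤ)
      lemma = solve-∀

    w-telescope : ∀ x k → k ≤ N → w (1ℤ ℤ.+ x) (suc k) ℤ.+ w x (suc k) ≡
                  + 2 ℤ.* (W (1ℤ ℤ.+ x) (suc k) ℤ.- W (1ℤ ℤ.+ x) k) mod m
    w-telescope x k k≤N = linear₂ ((x ℤ.+ + 2 ℤ.+ + k) ℤ.* (inv k ℤ.* inv k)) ((x ℤ.- + k) ℤ.* (inv k ℤ.* inv k))
      (W-w (1ℤ ℤ.+ x) k k≤N) (W-w′ x k k≤N)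
      (lemma x (+ k) (inv k) (W (1ℤ ℤ.+ x) k) (w (1ℤ ℤ.+ x) k) (w x k))
      where
      lemma : ∀ x k i W w′ w →
        (w′ ℤ.* (k ℤ.* (1ℤ ℤ.+ k) ℤ.- (1ℤ ℤ.+ x) ℤ.* (1ℤ ℤ.+ (1ℤ ℤ.+ x))) ℤ.* (i ℤ.* i)
          ℤ.+ w ℤ.* (k ℤ.* (1ℤ ℤ.+ k) ℤ.- x ℤ.* (1ℤ ℤ.+ x)) ℤ.* (i ℤ.* i))
        ℤ.- + 2 ℤ.* (W ℤ.* (1ℤ ℤ.- ((1ℤ ℤ.+ x) ℤ.* i) ℤ.* ((1ℤ ℤ.+ x) ℤ.* i)) ℤ.- W)
        ≡ ((x ℤ.+ + 2 ℤ.+ k) ℤ.* (i ℤ.* i)) ℤ.* ((1ℤ ℤ.+ x) ℤ.* W ℤ.- ((1ℤ ℤ.+ x) ℤ.- k) ℤ.* w′)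
          ℤ.+ ((x ℤ.- k) ℤ.* (i ℤ.* i)) ℤ.* ((1ℤ ℤ.+ x) ℤ.* W ℤ.- (1ℤ ℤ.+ x ℤ.+ k) ℤ.* w)
      lemma = solve-∀

    -- Summation by parts.
    S-step : ∀ x n → n ≤ N → S (suc n) (1ℤ ℤ.+ x) ℤ.+ S (suc n) x ≡
             + 2 ℤ.* (W (1ℤ ℤ.+ x) n ℤ.* h n ℤ.- P (1ℤ ℤ.+ x) n) mod m
    S-step x zero    _   = mod-refl
    S-step x (suc n) n<N = linear₂ 1ℤ (h (suc n))
      (S-step x n (ℕ.<⇒≤ n<N)) (w-telescope x n (ℕ.<⇒≤ n<N))
      (lemma (S (suc n) (1ℤ ℤ.+ x)) (S (suc n) x) (w (1ℤ ℤ.+ x) (suc n)) (w x (suc n)) (h n) (inv n)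
        (W (1ℤ ℤ.+ x) (suc n)) (W (1ℤ ℤ.+ x) n) (P (1ℤ ℤ.+ x) n))
      where
      lemma : ∀ s′ s w′ w h i W′ W P →
        (s′ ℤ.+ w′ ℤ.* (h ℤ.+ i) ℤ.+ (s ℤ.+ w ℤ.* (h ℤ.+ i)))
          ℤ.- + 2 ℤ.* (W′ ℤ.* (h ℤ.+ i) ℤ.- (P ℤ.+ W ℤ.* i))
        ≡ 1ℤ ℤ.* (s′ ℤ.+ s ℤ.- + 2 ℤ.* (W ℤ.* h ℤ.- P))
          ℤ.+ (h ℤ.+ i) ℤ.* (w′ ℤ.+ w ℤ.- + 2 ℤ.* (W′ ℤ.- W))
      lemma = solve-∀

    ∑w/k : ∀ x n → n ≤ N → x ℤ.* (1ℤ ℤ.+ x) ℤ.* ∑ n (λ k → w x k ℤ.* inv k) ≡ ℤ.- (+ n ℤ.* w x n) mod m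
    ∑w/k x zero    _   = mod-reflexive (lemma x)
      where
      lemma : ∀ x → x ℤ.* (1ℤ ℤ.+ x) ℤ.* 0ℤ ≡ ℤ.- (+ 0 ℤ.* 1ℤ)
      lemma = solve-∀
    ∑w/k x (suc n) n<N = linear₂ 1ℤ (w x n ℤ.* (+ n ℤ.+ (+ n ℤ.* + suc n ℤ.- x ℤ.* (1ℤ ℤ.+ x)) ℤ.* inv n))
      (∑w/k x n (ℕ.<⇒≤ n<N)) (inv-law n<N) (lemma x (+ n) (inv n) (∑ n (λ k → w x k ℤ.* inv k)) (w x n))
      where
      lemma : ∀ x n i s w →
        x ℤ.* (1ℤ ℤ.+ x) ℤ.* (s ℤ.+ w ℤ.* i)
          ℤ.- ℤ.- ((1ℤ ℤ.+ n) ℤ.* (w ℤ.* (n ℤ.* (1ℤ ℤ.+ n) ℤ.- x ℤ.* (1ℤ ℤ.+ x)) ℤ.* (i ℤ.* i)))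
        ≡ 1ℤ ℤ.* (x ℤ.* (1ℤ ℤ.+ x) ℤ.* s ℤ.- ℤ.- (n ℤ.* w))
          ℤ.+ w ℤ.* (n ℤ.+ (n ℤ.* (1ℤ ℤ.+ n) ℤ.- x ℤ.* (1ℤ ℤ.+ x)) ℤ.* i)
              ℤ.* ((1ℤ ℤ.+ n) ℤ.* i ℤ.- 1ℤ)
      lemma = solve-∀

    P-step : ∀ x n → n ≤ N → x ℤ.* P x n ℤ.+ (1ℤ ℤ.+ x) ℤ.* P (1ℤ ℤ.+ x) n ≡
             (+ 2 ℤ.* x ℤ.+ 1ℤ) ℤ.* ∑ n (λ k → w x k ℤ.* inv k) mod m
    P-step x zero    _   = mod-reflexive (lemma x)
      where
      lemma : ∀ x → x ℤ.* 0ℤ ℤ.+ (1ℤ ℤ.+ x) ℤ.* 0ℤ ≡ (+ 2 ℤ.* x ℤ.+ 1ℤ) ℤ.* 0ℤ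
      lemma = solve-∀
    P-step x (suc n) n<N = linear₃ 1ℤ (inv n) (inv n)
      (P-step x n n≤N) (W-w x n n≤N) (W-w′ x n n≤N)
      (lemma x (+ n) (inv n) (P x n) (P (1ℤ ℤ.+ x) n) (∑ n (λ k → w x k ℤ.* inv k)) (W x n) (W (1ℤ ℤ.+ x) n) (w x n))
      where
      n≤N : n ≤ N
      n≤N = ℕ.<⇒≤ n<N

      lemma : ∀ x n i P P′ s W W′ w →
        x ℤ.* (P ℤ.+ W ℤ.* i) ℤ.+ (1ℤ ℤ.+ x) ℤ.* (P′ ℤ.+ W′ ℤ.* i)
          ℤ.- (+ 2 ℤ.* x ℤ.+ 1ℤ) ℤ.* (s ℤ.+ w ℤ.* i)
        ≡ 1ℤ ℤ.* (x ℤ.* P ℤ.+ (1ℤ ℤ.+ x) ℤ.* P′ ℤ.- (+ 2 ℤ.* x ℤ.+ 1ℤ) ℤ.* s)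
          ℤ.+ i ℤ.* (x ℤ.* W ℤ.- (x ℤ.- n) ℤ.* w)
          ℤ.+ i ℤ.* ((1ℤ ℤ.+ x) ℤ.* W′ ℤ.- (1ℤ ℤ.+ x ℤ.+ n) ℤ.* w)
      lemma = solve-∀

    w-vanishes : ∀ {n k} → n ℕ.<′ k → w (+ n) k ≡ 0ℤ
    w-vanishes {n} ℕ.<′-base = lemma (+ n) (w (+ n) n) (inv n)
      where
      lemma : ∀ n w i → w ℤ.* (n ℤ.* (1ℤ ℤ.+ n) ℤ.- n ℤ.* (1ℤ ℤ.+ n)) ℤ.* (i ℤ.* i) ≡ 0ℤ
      lemma = solve-∀
    w-vanishes {n} {suc k} (ℕ.≤′-step n<k) rewrite w-vanishes n<k = refl

    W-vanishes : ∀ {n k} → n ℕ.<′ k → k ≤ N → W (+ suc n) k ≡ 0ℤ mod m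
    W-vanishes {n} ℕ.<′-base n<N = linear₁ (ℤ.- W (+ suc n) n ℤ.* (1ℤ ℤ.+ + suc n ℤ.* inv n))
      (inv-law n<N) (lemma (+ suc n) (W (+ suc n) n) (inv n))
      where
      lemma : ∀ n w i → w ℤ.* (1ℤ ℤ.- (n ℤ.* i) ℤ.* (n ℤ.* i)) ℤ.- 0ℤ ≡
                        (ℤ.- w ℤ.* (1ℤ ℤ.+ n ℤ.* i)) ℤ.* (n ℤ.* i ℤ.- 1ℤ)
      lemma = solve-∀
    W-vanishes {n} {suc k} (ℕ.≤′-step n<k) k<N =
      *-mod (W-vanishes n<k (ℕ.<⇒≤ k<N)) (mod-refl {x = 1ℤ ℤ.- (+ suc n ℤ.* inv k) ℤ.* (+ suc n ℤ.* inv k)})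

    P-one : ∀ n → n < N → P 1ℤ (suc n) ≡ 1ℤ mod m
    P-one zero    0<N = mod-trans (mod-reflexive (lemma (inv 0))) (inv-law 0<N)
      where
      lemma : ∀ i → 0ℤ ℤ.+ 1ℤ ℤ.* i ≡ 1ℤ ℤ.* i
      lemma = solve-∀
    P-one (suc n) n<N = +-mod (P-one n (ℕ.<⇒≤ n<N))
      (*-mod (W-vanishes (ℕ.s≤′s ℕ.z≤′n) (ℕ.<⇒≤ n<N)) (mod-refl {x = inv (suc n)}))

    P-value : ∀ j → j < N → + suc j ℤ.* P (+ suc j) N ≡ sgn j mod m
    P-value zero    0<N = mod-trans (mod-reflexive (ℤ.*-identityˡ (P 1ℤ N)))
      (subst (λ n → P 1ℤ n ≡ 1ℤ mod m) (ℕ.suc-pred N) (P-one (ℕ.pred N) (ℕ.≤-reflexive (ℕ.suc-pred N))))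
      where
      instance
        _ : ℕ.NonZero N
        _ = ℕ.>-nonZero 0<N
    P-value (suc j) j<N = linear₃ 1ℤ (ℤ.- 1ℤ) (+ 2 ℤ.* + suc j ℤ.+ 1ℤ)
      (P-step (+ suc j) N ℕ.≤-refl) (P-value j (ℕ.<⇒≤ j<N)) ∑≡0
      (lemma (+ suc j) (P (+ suc j) N) (P (+ suc (suc j)) N) (sgn j) (∑ N (λ k → w (+ suc j) k ℤ.* inv k)))
      where
      lemma : ∀ j P P′ σ s → (1ℤ ℤ.+ j) ℤ.* P′ ℤ.- ℤ.- σ ≡
        1ℤ ℤ.* (j ℤ.* P ℤ.+ (1ℤ ℤ.+ j) ℤ.* P′ ℤ.- (+ 2 ℤ.* j ℤ.+ 1ℤ) ℤ.* s)
          ℤ.+ ℤ.- 1ℤ ℤ.* (j ℤ.* P ℤ.- σ) ℤ.+ (+ 2 ℤ.* j ℤ.+ 1ℤ) ℤ.* (s ℤ.- 0ℤ)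
      lemma = solve-∀

      unit : + suc j ℤ.* + suc (suc j) ℤ.* (inv j ℤ.* inv (suc j)) ≡ 1ℤ mod m
      unit = mod-trans (mod-reflexive (lemma′ (+ suc j) (+ suc (suc j)) (inv j) (inv (suc j))))
        (*-mod (inv-law (ℕ.<⇒≤ j<N)) (inv-law j<N))
        where
        lemma′ : ∀ a b c d → a ℤ.* b ℤ.* (c ℤ.* d) ≡ (a ℤ.* c) ℤ.* (b ℤ.* d)
        lemma′ = solve-∀

      ∑≡0 : ∑ N (λ k → w (+ suc j) k ℤ.* inv k) ≡ 0ℤ mod m
      ∑≡0 = *-cancel-unit {u = + suc j ℤ.* + suc (suc j)} unit (begin
        + suc j ℤ.* + suc (suc j) ℤ.* ∑ N (λ k → w (+ suc j) k ℤ.* inv k) ≈⟨ ∑w/k (+ suc j) N ℕ.≤-refl ⟩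
        ℤ.- (+ N ℤ.* w (+ suc j) N)  ≡⟨ cong (λ z → ℤ.- (+ N ℤ.* z)) (w-vanishes (ℕ.<⇒<′ j<N)) ⟩
        ℤ.- (+ N ℤ.* 0ℤ)             ≡⟨ cong ℤ.-_ (ℤ.*-zeroʳ (+ N)) ⟩
        0ℤ                           ∎)

    S-zero : ∀ n → S n 0ℤ ≡ 0ℤ
    S-zero zero          = refl
    S-zero (suc zero)    = refl
    S-zero (suc (suc n)) rewrite S-zero (suc n) | w-vanishes {0} {suc n} (ℕ.s≤′s ℕ.z≤′n) = refl

    S-value : ∀ n → n ≤ N → S (suc N) (+ n) ≡ sgn n ℤ.* (+ 2 ℤ.* h n) mod m
    S-value zero    _   = mod-reflexive (S-zero (suc N))
    S-value (suc n) n<N = linear₃ 1ℤ (ℤ.- 1ℤ) 1ℤ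
      (S-step (+ n) N ℕ.≤-refl) (S-value n (ℕ.<⇒≤ n<N)) W-P
      (lemma (S (suc N) (+ suc n)) (S (suc N) (+ n)) (W (+ suc n) N) (h N) (P (+ suc n) N) (sgn n) (h n) (inv n))
      where
      lemma : ∀ S′ S W H P σ h i → S′ ℤ.- ℤ.- σ ℤ.* (+ 2 ℤ.* (h ℤ.+ i)) ≡
        1ℤ ℤ.* (S′ ℤ.+ S ℤ.- + 2 ℤ.* (W ℤ.* H ℤ.- P)) ℤ.+ ℤ.- 1ℤ ℤ.* (S ℤ.- σ ℤ.* (+ 2 ℤ.* h))
          ℤ.+ 1ℤ ℤ.* (+ 2 ℤ.* (W ℤ.* H ℤ.- P) ℤ.- ℤ.- (+ 2 ℤ.* (i ℤ.* σ)))
      lemma = solve-∀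

      lemma′ : ∀ W H P σ i j → + 2 ℤ.* (W ℤ.* H ℤ.- P) ℤ.- ℤ.- (+ 2 ℤ.* (i ℤ.* σ)) ≡
        (+ 2 ℤ.* H) ℤ.* (W ℤ.- 0ℤ) ℤ.+ (ℤ.- + 2 ℤ.* i) ℤ.* (j ℤ.* P ℤ.- σ)
          ℤ.+ (+ 2 ℤ.* P) ℤ.* (j ℤ.* i ℤ.- 1ℤ)
      lemma′ = solve-∀

      W-P : + 2 ℤ.* (W (+ suc n) N ℤ.* h N ℤ.- P (+ suc n) N) ≡ ℤ.- (+ 2 ℤ.* (inv n ℤ.* sgn n)) mod m
      W-P = linear₃ (+ 2 ℤ.* h N) (ℤ.- + 2 ℤ.* inv n) (+ 2 ℤ.* P (+ suc n) N)
        (W-vanishes (ℕ.<⇒<′ n<N) ℕ.≤-refl) (P-value n n<N) (inv-law n<N)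
        (lemma′ (W (+ suc n) N) (h N) (P (+ suc n) N) (sgn n) (inv n) (+ suc n))

scale-mod : ∀ {m x y} c → x ≡ y mod m → c ℤ.* x ≡ c ℤ.* y mod (c ℤ.* m)
scale-mod {m} {x} {y} c (∣⇒mod (divides q eq)) = ∣⇒mod (divides q
  (trans (lemma c x y) (trans (cong (c ℤ.*_) eq) (lemma′ c q m))))
  where
  lemma : ∀ c x y → c ℤ.* x ℤ.- c ℤ.* y ≡ c ℤ.* (x ℤ.- y)
  lemma = solve-∀
  lemma′ : ∀ c q m → c ℤ.* (q ℤ.* m) ≡ q ℤ.* (c ℤ.* m)
  lemma′ = solve-∀

-- Values f(y+tp), f(y), f(y-p) of a polynomial f: modulo p², f is affine along y + pℤ.
record Affine (p t x y z : ℤ) : Set where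
  constructor affine
  field
    interpolate : x ≡ (1ℤ ℤ.+ t) ℤ.* y ℤ.- t ℤ.* z mod (p ℤ.* p)
    congruent   : y ≡ z mod p

open Affine

module _ {p t : ℤ} where

  Affine-const : ∀ c → Affine p t c c c
  Affine-const c = affine (mod-reflexive (lemma t c)) mod-refl
    where
    lemma : ∀ t c → c ≡ (1ℤ ℤ.+ t) ℤ.* c ℤ.- t ℤ.* c
    lemma = solve-∀

  Affine-+ : ∀ {x y z x′ y′ z′} → Affine p t x y z → Affine p t x′ y′ z′ →
             Affine p t (x ℤ.+ x′) (y ℤ.+ y′) (z ℤ.+ z′)
  Affine-+ {x} {y} {z} {x′} {y′} {z′} (affine i c) (affine i′ c′) =
    affine (linear₂ 1ℤ 1ℤ i i′ (lemma t x y z x′ y′ z′)) (+-mod c c′)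
    where
    lemma : ∀ t x y z x′ y′ z′ →
      x ℤ.+ x′ ℤ.- ((1ℤ ℤ.+ t) ℤ.* (y ℤ.+ y′) ℤ.- t ℤ.* (z ℤ.+ z′)) ≡
      1ℤ ℤ.* (x ℤ.- ((1ℤ ℤ.+ t) ℤ.* y ℤ.- t ℤ.* z)) ℤ.+ 1ℤ ℤ.* (x′ ℤ.- ((1ℤ ℤ.+ t) ℤ.* y′ ℤ.- t ℤ.* z′))
    lemma = solve-∀

  Affine-* : ∀ {x y z x′ y′ z′} → Affine p t x y z → Affine p t x′ y′ z′ →
             Affine p t (x ℤ.* x′) (y ℤ.* y′) (z ℤ.* z′)
  Affine-* {x} {y} {z} {x′} {y′} {z′} (affine i c) (affine i′ c′) =
    affine
      (linear₃ x′ ((1ℤ ℤ.+ t) ℤ.* y ℤ.- t ℤ.* z) (t ℤ.* (1ℤ ℤ.+ t)) i i′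
        (∣⇒≡0 {x = (y ℤ.- z) ℤ.* (y′ ℤ.- z′)} (*-mono-∣ (divisible c) (divisible c′)))
        (lemma t x y z x′ y′ z′))
      (*-mod c c′)
    where
    *-mono-∣ : ∀ {a b} → p ∣ a → p ∣ b → p ℤ.* p ∣ a ℤ.* b
    *-mono-∣ (divides q refl) (divides r refl) = divides (q ℤ.* r) (rearrange p q r)
      where
      rearrange : ∀ p q r → q ℤ.* p ℤ.* (r ℤ.* p) ≡ q ℤ.* r ℤ.* (p ℤ.* p)
      rearrange = solve-∀

    lemma : ∀ t x y z x′ y′ z′ →
      x ℤ.* x′ ℤ.- ((1ℤ ℤ.+ t) ℤ.* (y ℤ.* y′) ℤ.- t ℤ.* (z ℤ.* z′)) ≡
      x′ ℤ.* (x ℤ.- ((1ℤ ℤ.+ t) ℤ.* y ℤ.- t ℤ.* z))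
        ℤ.+ ((1ℤ ℤ.+ t) ℤ.* y ℤ.- t ℤ.* z) ℤ.* (x′ ℤ.- ((1ℤ ℤ.+ t) ℤ.* y′ ℤ.- t ℤ.* z′))
        ℤ.+ (t ℤ.* (1ℤ ℤ.+ t)) ℤ.* ((y ℤ.- z) ℤ.* (y′ ℤ.- z′) ℤ.- 0ℤ)
    lemma = solve-∀

module Supercongruence
  (inv : ℕ → ℤ) (N : ℕ)
  (inv-law : ∀ {k} → k < N → + suc k ℤ.* inv k ≡ 1ℤ mod (+ suc N ℤ.* + suc N))
  where

  private
    p : ℤ
    p = + suc N

  open Harmonic inv
  open Recurrences (p ℤ.* p) N inv-law

  module _ (s : ℕ) (s≤N : s ≤ N) (t : ℤ) where

    private
      N∸s : + N ≡ + s ℤ.+ + (N ∸ s)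
      N∸s = cong +_ (sym (ℕ.m+[n∸m]≡n s≤N))

      reflect : + (N ∸ s) ≡ + N ℤ.- + s
      reflect = trans (lemma (+ s) (+ (N ∸ s))) (cong (ℤ._- + s) (sym N∸s))
        where
        lemma : ∀ s c → c ≡ s ℤ.+ c ℤ.- s
        lemma = solve-∀

    A : ℕ → ℤ → ℤ
    A k x = + k ℤ.* + suc k ℤ.- x ℤ.* (1ℤ ℤ.+ x)

    A-affine : ∀ k → Affine p t (A k (+ s ℤ.+ t ℤ.* p)) (A k (+ s)) (A k (+ (N ∸ s)))
    A-affine k = subst (λ z → Affine p t (A k (+ s ℤ.+ t ℤ.* p)) (A k (+ s)) (A k z)) (sym reflect) (affine
      (∣⇒mod (divides (ℤ.- (t ℤ.* (1ℤ ℤ.+ t))) (lemma₂ (+ k) (+ N) (+ s) t)))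
      (∣⇒mod (divides (+ N ℤ.- + 2 ℤ.* + s) (lemma₁ (+ k) (+ N) (+ s)))))
      where
      lemma₁ : ∀ k N s → (k ℤ.* (1ℤ ℤ.+ k) ℤ.- s ℤ.* (1ℤ ℤ.+ s))
                 ℤ.- (k ℤ.* (1ℤ ℤ.+ k) ℤ.- (N ℤ.- s) ℤ.* (1ℤ ℤ.+ (N ℤ.- s)))
               ≡ (N ℤ.- + 2 ℤ.* s) ℤ.* (1ℤ ℤ.+ N)
      lemma₁ = solve-∀
      lemma₂ : ∀ k N s t → (k ℤ.* (1ℤ ℤ.+ k) ℤ.- (s ℤ.+ t ℤ.* (1ℤ ℤ.+ N)) ℤ.* (1ℤ ℤ.+ (s ℤ.+ t ℤ.* (1ℤ ℤ.+ N))))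
                 ℤ.- ((1ℤ ℤ.+ t) ℤ.* (k ℤ.* (1ℤ ℤ.+ k) ℤ.- s ℤ.* (1ℤ ℤ.+ s))
                   ℤ.- t ℤ.* (k ℤ.* (1ℤ ℤ.+ k) ℤ.- (N ℤ.- s) ℤ.* (1ℤ ℤ.+ (N ℤ.- s))))
               ≡ ℤ.- (t ℤ.* (1ℤ ℤ.+ t)) ℤ.* ((1ℤ ℤ.+ N) ℤ.* (1ℤ ℤ.+ N))
      lemma₂ = solve-∀

    w-affine : ∀ k → Affine p t (w (+ s ℤ.+ t ℤ.* p) k) (w (+ s) k) (w (+ (N ∸ s)) k)
    w-affine zero    = Affine-const 1ℤ
    w-affine (suc k) = Affine-* (Affine-* (w-affine k) (A-affine k)) (Affine-const (inv k ℤ.* inv k))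

    S-affine : ∀ n → Affine p t (S n (+ s ℤ.+ t ℤ.* p)) (S n (+ s)) (S n (+ (N ∸ s)))
    S-affine zero    = Affine-const 0ℤ
    S-affine (suc n) = Affine-+ (S-affine n) (Affine-* (w-affine n) (Affine-const (h n)))

  h-reflect : ∀ s → s ≤ N → h (N ∸ s) ≡ h N ℤ.+ h s ℤ.+ p ℤ.* h₂ s mod (p ℤ.* p)
  h-reflect zero    _   = mod-reflexive (lemma (h N) p)
    where
    lemma : ∀ h p → h ≡ h ℤ.+ 0ℤ ℤ.+ p ℤ.* 0ℤ
    lemma = solve-∀
  h-reflect (suc s) s<N = linear₂ 1ℤ (ℤ.- 1ℤ) step inverse
    (lemma (h (N ∸ suc s)) (inv (N ∸ suc s)) (h N) (h s) p (h₂ s) (inv s))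
    where
    lemma : ∀ h′ j H h p h₂ i →
      h′ ℤ.- (H ℤ.+ (h ℤ.+ i) ℤ.+ p ℤ.* (h₂ ℤ.+ i ℤ.* i)) ≡
      1ℤ ℤ.* (h′ ℤ.+ j ℤ.- (H ℤ.+ h ℤ.+ p ℤ.* h₂)) ℤ.+ ℤ.- 1ℤ ℤ.* (j ℤ.- ℤ.- (i ℤ.+ p ℤ.* (i ℤ.* i)))
    lemma = solve-∀

    split : N ∸ s ≡ suc (N ∸ suc s)
    split = ℕ.+-∸-assoc 1 s<N

    step : h (N ∸ suc s) ℤ.+ inv (N ∸ suc s) ≡ h N ℤ.+ h s ℤ.+ p ℤ.* h₂ s mod (p ℤ.* p)
    step = subst (λ n → h n ≡ h N ℤ.+ h s ℤ.+ p ℤ.* h₂ s mod (p ℤ.* p)) split (h-reflect s (ℕ.<⇒≤ s<N))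

    complement : + suc (N ∸ suc s) ≡ p ℤ.- + suc s
    complement = trans (lemma′ (+ suc s) (+ suc (N ∸ suc s)))
      (cong (ℤ._- + suc s) (cong +_ (trans (ℕ.+-suc (suc s) (N ∸ suc s)) (cong suc (ℕ.m+[n∸m]≡n s<N)))))
      where
      lemma′ : ∀ s c → c ≡ s ℤ.+ c ℤ.- s
      lemma′ = solve-∀

    inverse : inv (N ∸ suc s) ≡ ℤ.- (inv s ℤ.+ p ℤ.* (inv s ℤ.* inv s)) mod (p ℤ.* p)
    inverse = inverse-unique {u = p ℤ.- + suc s}
      (subst (λ z → z ℤ.* inv (N ∸ suc s) ≡ 1ℤ mod (p ℤ.* p)) complement
        (inv-law (ℕ.≤-trans (ℕ.≤-reflexive (sym split)) (ℕ.m∸n≤m N s))))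
      (linear₂ (1ℤ ℤ.+ p ℤ.* inv s) (ℤ.- (inv s ℤ.* inv s)) (inv-law s<N) p²≡0
        (lemma′ p (+ suc s) (inv s)))
      where
      p²≡0 : p ℤ.* p ≡ 0ℤ mod (p ℤ.* p)
      p²≡0 = ∣⇒≡0 (divides 1ℤ (sym (ℤ.*-identityˡ (p ℤ.* p))))

      lemma′ : ∀ p s i → (p ℤ.- s) ℤ.* ℤ.- (i ℤ.+ p ℤ.* (i ℤ.* i)) ℤ.- 1ℤ ≡
        (1ℤ ℤ.+ p ℤ.* i) ℤ.* (s ℤ.* i ℤ.- 1ℤ) ℤ.+ ℤ.- (i ℤ.* i) ℤ.* (p ℤ.* p ℤ.- 0ℤ)
      lemma′ = solve-∀

  -- Reflecting the whole range gives 0 = 2 H_{p-1} + p H_{p-1}^{(2)}.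
  wolstenholme : ∀ {u} → + 2 ℤ.* u ≡ 1ℤ mod (p ℤ.* p) → h₂ N ≡ 0ℤ mod p → h N ≡ 0ℤ mod (p ℤ.* p)
  wolstenholme {u} unit h₂≡0 = *-cancel-unit {u = + 2} unit
    (linear₂ (ℤ.- 1ℤ) (ℤ.- 1ℤ) reflected p*h₂≡0 (lemma (h N) (p ℤ.* h₂ N)))
    where
    reflected : 0ℤ ≡ h N ℤ.+ h N ℤ.+ p ℤ.* h₂ N mod (p ℤ.* p)
    reflected = subst (λ n → h n ≡ h N ℤ.+ h N ℤ.+ p ℤ.* h₂ N mod (p ℤ.* p)) (ℕ.n∸n≡0 N) (h-reflect N ℕ.≤-refl)

    p*h₂≡0 : p ℤ.* h₂ N ≡ 0ℤ mod (p ℤ.* p)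
    p*h₂≡0 = mod-trans (scale-mod p h₂≡0) (mod-reflexive (ℤ.*-zeroʳ p))

    lemma : ∀ h q → + 2 ℤ.* h ℤ.- 0ℤ ≡ ℤ.- 1ℤ ℤ.* (0ℤ ℤ.- (h ℤ.+ h ℤ.+ q)) ℤ.+ ℤ.- 1ℤ ℤ.* (q ℤ.- 0ℤ)
    lemma = solve-∀

  supercongruence : h N ≡ 0ℤ mod (p ℤ.* p) → sgn N ≡ 1ℤ → ∀ s → s ≤ N → ∀ t →
    S (suc N) (+ s ℤ.+ t ℤ.* p) ≡ sgn s ℤ.* (+ 2 ℤ.* (h s ℤ.- t ℤ.* p ℤ.* h₂ s)) mod (p ℤ.* p)
  supercongruence hN≡0 sgnN s s≤N t = begin
    S (suc N) (+ s ℤ.+ t ℤ.* p)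
      ≈⟨ interpolate (S-affine s s≤N t (suc N)) ⟩
    (1ℤ ℤ.+ t) ℤ.* S (suc N) (+ s) ℤ.- t ℤ.* S (suc N) (+ (N ∸ s))
      ≈⟨ linear₂ (1ℤ ℤ.+ t) (ℤ.- t) (S-value s s≤N) (S-value (N ∸ s) (ℕ.m∸n≤m N s))
           (lemma₁ t (S (suc N) (+ s)) (S (suc N) (+ (N ∸ s))) _ _) ⟩
    (1ℤ ℤ.+ t) ℤ.* (sgn s ℤ.* (+ 2 ℤ.* h s)) ℤ.- t ℤ.* (sgn (N ∸ s) ℤ.* (+ 2 ℤ.* h (N ∸ s)))
      ≡⟨ cong (λ z → (1ℤ ℤ.+ t) ℤ.* (sgn s ℤ.* (+ 2 ℤ.* h s)) ℤ.- t ℤ.* (z ℤ.* (+ 2 ℤ.* h (N ∸ s)))) (sgn-reflect s s≤N) ⟩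
    (1ℤ ℤ.+ t) ℤ.* (sgn s ℤ.* (+ 2 ℤ.* h s)) ℤ.- t ℤ.* (sgn s ℤ.* (+ 2 ℤ.* h (N ∸ s)))
      ≈⟨ linear₂ (ℤ.- t ℤ.* sgn s ℤ.* + 2) (ℤ.- t ℤ.* sgn s ℤ.* + 2) (h-reflect s s≤N) hN≡0
           (lemma₂ t (sgn s) (h s) (h (N ∸ s)) (h N) p (h₂ s)) ⟩
    sgn s ℤ.* (+ 2 ℤ.* (h s ℤ.- t ℤ.* p ℤ.* h₂ s)) ∎
    where
    open ≡-mod-Reasoning (p ℤ.* p)

    lemma₁ : ∀ t x y x′ y′ → ((1ℤ ℤ.+ t) ℤ.* x ℤ.- t ℤ.* y) ℤ.- ((1ℤ ℤ.+ t) ℤ.* x′ ℤ.- t ℤ.* y′) ≡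
      (1ℤ ℤ.+ t) ℤ.* (x ℤ.- x′) ℤ.+ ℤ.- t ℤ.* (y ℤ.- y′)
    lemma₁ = solve-∀

    lemma₂ : ∀ t σ h h′ H p h₂ →
      ((1ℤ ℤ.+ t) ℤ.* (σ ℤ.* (+ 2 ℤ.* h)) ℤ.- t ℤ.* (σ ℤ.* (+ 2 ℤ.* h′)))
        ℤ.- σ ℤ.* (+ 2 ℤ.* (h ℤ.- t ℤ.* p ℤ.* h₂)) ≡
      (ℤ.- t ℤ.* σ ℤ.* + 2) ℤ.* (h′ ℤ.- (H ℤ.+ h ℤ.+ p ℤ.* h₂)) ℤ.+ (ℤ.- t ℤ.* σ ℤ.* + 2) ℤ.* (H ℤ.- 0ℤ)
    lemma₂ = solve-∀

    sgn-reflect : ∀ s → s ≤ N → sgn (N ∸ s) ≡ sgn s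
    sgn-reflect zero    _   = sgnN
    sgn-reflect (suc s) s<N = trans (sym (ℤ.neg-involutive (sgn (N ∸ suc s))))
      (cong ℤ.-_ (trans (cong sgn (sym (ℕ.+-∸-assoc 1 s<N))) (sgn-reflect s (ℕ.<⇒≤ s<N))))

-- Binomial convolution

infixl 7 _⋆_

D : (ℕ → ℤ) → ℕ → ℤ
D f n = f (suc n)

-- Binomial convolution ∑ₖ C(n,k) f(k) g(n-k), i.e. the product of exponential
-- generating functions; with this definition its algebra follows from the Leibniz rule.
_⋆_ : (ℕ → ℤ) → (ℕ → ℤ) → ℕ → ℤ
(f ⋆ g) zero    = f 0 ℤ.* g 0
(f ⋆ g) (suc n) = (D f ⋆ g) n ℤ.+ (f ⋆ D g) n

⋆-cong : ∀ {m f f′ g g′} n → (∀ {k} → k ≤ n → f k ≡ f′ k mod m) → (∀ {k} → k ≤ n → g k ≡ g′ k mod m) →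
         (f ⋆ g) n ≡ (f′ ⋆ g′) n mod m
⋆-cong zero    e e′ = *-mod (e z≤n) (e′ z≤n)
⋆-cong (suc n) e e′ = +-mod (⋆-cong n (e ∘ s≤s) (e′ ∘ ℕ.m≤n⇒m≤1+n)) (⋆-cong n (e ∘ ℕ.m≤n⇒m≤1+n) (e′ ∘ s≤s))

⋆-cong-≡ : ∀ {f f′ g g′} → (∀ k → f k ≡ f′ k) → (∀ k → g k ≡ g′ k) → ∀ n → (f ⋆ g) n ≡ (f′ ⋆ g′) n
⋆-cong-≡ e e′ zero    = cong₂ ℤ._*_ (e 0) (e′ 0)
⋆-cong-≡ e e′ (suc n) = cong₂ ℤ._+_ (⋆-cong-≡ (e ∘ suc) e′ n) (⋆-cong-≡ e (e′ ∘ suc) n)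

⋆-comm : ∀ f g n → (f ⋆ g) n ≡ (g ⋆ f) n
⋆-comm f g zero    = ℤ.*-comm (f 0) (g 0)
⋆-comm f g (suc n) = trans (cong₂ ℤ._+_ (⋆-comm (D f) g n) (⋆-comm f (D g) n)) (ℤ.+-comm ((g ⋆ D f) n) _)

⋆-linearˡ : ∀ c c′ f f′ g n → ((λ k → c ℤ.* f k ℤ.+ c′ ℤ.* f′ k) ⋆ g) n ≡ c ℤ.* (f ⋆ g) n ℤ.+ c′ ℤ.* (f′ ⋆ g) n
⋆-linearˡ c c′ f f′ g zero    = lemma c c′ (f 0) (f′ 0) (g 0)
  where
  lemma : ∀ c c′ f f′ g → (c ℤ.* f ℤ.+ c′ ℤ.* f′) ℤ.* g ≡ c ℤ.* (f ℤ.* g) ℤ.+ c′ ℤ.* (f′ ℤ.* g)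
  lemma = solve-∀
⋆-linearˡ c c′ f f′ g (suc n) = trans
  (cong₂ ℤ._+_ (⋆-linearˡ c c′ (D f) (D f′) g n) (⋆-linearˡ c c′ f f′ (D g) n))
  (lemma c c′ ((D f ⋆ g) n) ((D f′ ⋆ g) n) ((f ⋆ D g) n) ((f′ ⋆ D g) n))
  where
  lemma : ∀ c c′ a a′ b b′ → c ℤ.* a ℤ.+ c′ ℤ.* a′ ℤ.+ (c ℤ.* b ℤ.+ c′ ℤ.* b′) ≡ c ℤ.* (a ℤ.+ b) ℤ.+ c′ ℤ.* (a′ ℤ.+ b′)
  lemma = solve-∀

⋆-distribˡ : ∀ f f′ g n → ((λ k → f k ℤ.+ f′ k) ⋆ g) n ≡ (f ⋆ g) n ℤ.+ (f′ ⋆ g) n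
⋆-distribˡ f f′ g zero    = ℤ.*-distribʳ-+ (g 0) (f 0) (f′ 0)
⋆-distribˡ f f′ g (suc n) = trans
  (cong₂ ℤ._+_ (⋆-distribˡ (D f) (D f′) g n) (⋆-distribˡ f f′ (D g) n))
  (lemma ((D f ⋆ g) n) ((D f′ ⋆ g) n) ((f ⋆ D g) n) ((f′ ⋆ D g) n))
  where
  lemma : ∀ a a′ b b′ → a ℤ.+ a′ ℤ.+ (b ℤ.+ b′) ≡ a ℤ.+ b ℤ.+ (a′ ℤ.+ b′)
  lemma = solve-∀

⋆-distribʳ : ∀ f g g′ n → (f ⋆ (λ k → g k ℤ.+ g′ k)) n ≡ (f ⋆ g) n ℤ.+ (f ⋆ g′) n
⋆-distribʳ f g g′ n = trans (⋆-comm f _ n)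
  (trans (⋆-distribˡ g g′ f n) (cong₂ ℤ._+_ (⋆-comm g f n) (⋆-comm g′ f n)))

⋆-scaleˡ : ∀ c f g n → ((λ k → c ℤ.* f k) ⋆ g) n ≡ c ℤ.* (f ⋆ g) n
⋆-scaleˡ c f g zero    = ℤ.*-assoc c (f 0) (g 0)
⋆-scaleˡ c f g (suc n) = trans (cong₂ ℤ._+_ (⋆-scaleˡ c (D f) g n) (⋆-scaleˡ c f (D g) n))
  (sym (ℤ.*-distribˡ-+ c ((D f ⋆ g) n) ((f ⋆ D g) n)))

⋆-scaleʳ : ∀ c f g n → (f ⋆ (λ k → c ℤ.* g k)) n ≡ c ℤ.* (f ⋆ g) n
⋆-scaleʳ c f g n = trans (⋆-comm f _ n) (trans (⋆-scaleˡ c g f n) (cong (c ℤ.*_) (⋆-comm g f n)))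

⋆-assoc : ∀ f g k n → ((f ⋆ g) ⋆ k) n ≡ (f ⋆ (g ⋆ k)) n
⋆-assoc f g k zero    = ℤ.*-assoc (f 0) (g 0) (k 0)
⋆-assoc f g k (suc n) = begin
  ((λ j → (D f ⋆ g) j ℤ.+ (f ⋆ D g) j) ⋆ k) n ℤ.+ ((f ⋆ g) ⋆ D k) n
    ≡⟨ cong (λ z → z ℤ.+ ((f ⋆ g) ⋆ D k) n) (⋆-distribˡ (D f ⋆ g) (f ⋆ D g) k n) ⟩
  ((D f ⋆ g) ⋆ k) n ℤ.+ ((f ⋆ D g) ⋆ k) n ℤ.+ ((f ⋆ g) ⋆ D k) n
    ≡⟨ cong₂ ℤ._+_ (cong₂ ℤ._+_ (⋆-assoc (D f) g k n) (⋆-assoc f (D g) k n)) (⋆-assoc f g (D k) n) ⟩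
  (D f ⋆ (g ⋆ k)) n ℤ.+ (f ⋆ (D g ⋆ k)) n ℤ.+ (f ⋆ (g ⋆ D k)) n
    ≡⟨ ℤ.+-assoc ((D f ⋆ (g ⋆ k)) n) _ _ ⟩
  (D f ⋆ (g ⋆ k)) n ℤ.+ ((f ⋆ (D g ⋆ k)) n ℤ.+ (f ⋆ (g ⋆ D k)) n)
    ≡⟨ cong (λ z → (D f ⋆ (g ⋆ k)) n ℤ.+ z) (⋆-distribʳ f (D g ⋆ k) (g ⋆ D k) n) ⟨
  (D f ⋆ (g ⋆ k)) n ℤ.+ (f ⋆ (λ j → (D g ⋆ k) j ℤ.+ (g ⋆ D k) j)) n ∎
  where open ≡-Reasoning

pow : ℤ → ℕ → ℤ
pow x n = x ℤ.^ n

pow-⋆-pow : ∀ x y n → (pow x ⋆ pow y) n ≡ pow (x ℤ.+ y) n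
pow-⋆-pow x y zero    = refl
pow-⋆-pow x y (suc n) = trans
  (cong₂ ℤ._+_ (trans (⋆-scaleˡ x (pow x) (pow y) n) (cong (x ℤ.*_) (pow-⋆-pow x y n)))
               (trans (⋆-scaleʳ y (pow x) (pow y) n) (cong (y ℤ.*_) (pow-⋆-pow x y n))))
  (sym (ℤ.*-distribʳ-+ (pow (x ℤ.+ y) n) x y))

⋆-identityˡ : ∀ g n → (pow 0ℤ ⋆ g) n ≡ g n
⋆-identityˡ g zero    = ℤ.*-identityˡ (g 0)
⋆-identityˡ g (suc n) = trans (cong₂ ℤ._+_ (⋆-scaleˡ 0ℤ (pow 0ℤ) g n) (⋆-identityˡ (D g) n)) (ℤ.+-identityˡ _)

-- The exponential generating function of δ is the variable itself.
δ : ℕ → ℤ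
δ zero    = 0ℤ
δ (suc n) = pow 0ℤ n

δ-⋆ : ∀ g n → (δ ⋆ g) (suc n) ≡ + suc n ℤ.* g n
δ-⋆ g zero    = lemma (g 0) (g 1)
  where
  lemma : ∀ x y → 1ℤ ℤ.* x ℤ.+ 0ℤ ℤ.* y ≡ 1ℤ ℤ.* x
  lemma = solve-∀
δ-⋆ g (suc n) = trans (cong₂ ℤ._+_ (⋆-identityˡ g (suc n)) (δ-⋆ (D g) n)) (lemma (+ suc n) (g (suc n)))
  where
  lemma : ∀ n x → x ℤ.+ n ℤ.* x ≡ (1ℤ ℤ.+ n) ℤ.* x
  lemma = solve-∀

σ : (ℕ → ℤ) → ℕ → ℤ
σ f n = sgn n ℤ.* f n

σ-⋆ : ∀ f g n → σ (f ⋆ g) n ≡ (σ f ⋆ σ g) n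
σ-⋆ f g zero    = lemma (f 0) (g 0)
  where
  lemma : ∀ x y → 1ℤ ℤ.* (x ℤ.* y) ≡ (1ℤ ℤ.* x) ℤ.* (1ℤ ℤ.* y)
  lemma = solve-∀
σ-⋆ f g (suc n) = begin
  ℤ.- sgn n ℤ.* ((D f ⋆ g) n ℤ.+ (f ⋆ D g) n)
    ≡⟨ lemma (sgn n) ((D f ⋆ g) n) ((f ⋆ D g) n) ⟩
  ℤ.- 1ℤ ℤ.* σ (D f ⋆ g) n ℤ.+ ℤ.- 1ℤ ℤ.* σ (f ⋆ D g) n
    ≡⟨ cong₂ (λ x y → ℤ.- 1ℤ ℤ.* x ℤ.+ ℤ.- 1ℤ ℤ.* y) (σ-⋆ (D f) g n) (σ-⋆ f (D g) n) ⟩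
  ℤ.- 1ℤ ℤ.* (σ (D f) ⋆ σ g) n ℤ.+ ℤ.- 1ℤ ℤ.* (σ f ⋆ σ (D g)) n
    ≡⟨ cong₂ ℤ._+_ (⋆-scaleˡ (ℤ.- 1ℤ) (σ (D f)) (σ g) n) (⋆-scaleʳ (ℤ.- 1ℤ) (σ f) (σ (D g)) n) ⟨
  ((λ k → ℤ.- 1ℤ ℤ.* σ (D f) k) ⋆ σ g) n ℤ.+ (σ f ⋆ (λ k → ℤ.- 1ℤ ℤ.* σ (D g) k)) n
    ≡⟨ cong₂ ℤ._+_ (⋆-cong-≡ (Dσ f) (λ _ → refl) n) (⋆-cong-≡ (λ _ → refl) (Dσ g) n) ⟨
  (D (σ f) ⋆ σ g) n ℤ.+ (σ f ⋆ D (σ g)) n ∎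
  where
  open ≡-Reasoning
  lemma : ∀ s x y → ℤ.- s ℤ.* (x ℤ.+ y) ≡ ℤ.- 1ℤ ℤ.* (s ℤ.* x) ℤ.+ ℤ.- 1ℤ ℤ.* (s ℤ.* y)
  lemma = solve-∀
  lemma′ : ∀ s x → ℤ.- s ℤ.* x ≡ ℤ.- 1ℤ ℤ.* (s ℤ.* x)
  lemma′ = solve-∀
  Dσ : ∀ f k → D (σ f) k ≡ ℤ.- 1ℤ ℤ.* σ (D f) k
  Dσ f k = lemma′ (sgn k) (f (suc k))

σ-pow : ∀ x n → σ (pow x) n ≡ pow (ℤ.- x) n
σ-pow x zero    = refl
σ-pow x (suc n) = trans (lemma (sgn n) x (pow x n)) (cong (ℤ.- x ℤ.*_) (σ-pow x n))
  where
  lemma : ∀ s x y → ℤ.- s ℤ.* (x ℤ.* y) ≡ ℤ.- x ℤ.* (s ℤ.* y)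
  lemma = solve-∀

⋆-leading : ∀ {m} d g n → (∀ {k} → k < n → d k ≡ 0ℤ mod m) →
            (d ⋆ g) (suc n) ≡ + suc n ℤ.* (d n ℤ.* g 1) ℤ.+ d (suc n) ℤ.* g 0 mod m
⋆-leading d g zero    e = mod-reflexive (lemma (d 0) (d 1) (g 0) (g 1))
  where
  lemma : ∀ d₀ d₁ g₀ g₁ → d₁ ℤ.* g₀ ℤ.+ d₀ ℤ.* g₁ ≡ 1ℤ ℤ.* (d₀ ℤ.* g₁) ℤ.+ d₁ ℤ.* g₀
  lemma = solve-∀
⋆-leading {m} d g (suc n) e = mod-trans (+-mod (⋆-leading (D d) g n (e ∘ s≤s)) tail)
  (mod-reflexive (lemma (+ suc n) (d (suc n)) (d (suc (suc n))) (g 0) (g 1)))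
  where
  lemma : ∀ n d d′ g₀ g₁ → n ℤ.* (d ℤ.* g₁) ℤ.+ d′ ℤ.* g₀ ℤ.+ d ℤ.* g₁ ≡ (1ℤ ℤ.+ n) ℤ.* (d ℤ.* g₁) ℤ.+ d′ ℤ.* g₀
  lemma = solve-∀
  lemma′ : ∀ n d g₁ g₂ → n ℤ.* (0ℤ ℤ.* g₂) ℤ.+ d ℤ.* g₁ ≡ d ℤ.* g₁
  lemma′ = solve-∀
  tail : (d ⋆ D g) (suc n) ≡ d (suc n) ℤ.* g 1 mod m
  tail = mod-trans (⋆-leading d (D g) n (e ∘ ℕ.m<n⇒m<1+n))
    (mod-trans (+-mod (*-mod (mod-refl {x = + suc n}) (*-mod (e ℕ.≤-refl) (mod-refl {x = g 2}))) mod-refl)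
      (mod-reflexive (lemma′ (+ suc n) (d (suc n)) (g 1) (g 2))))

∑-+ : ∀ n f g → ∑ n (λ k → f k ℤ.+ g k) ≡ ∑ n f ℤ.+ ∑ n g
∑-+ zero    f g = refl
∑-+ (suc n) f g = trans (cong (ℤ._+ (f n ℤ.+ g n)) (∑-+ n f g)) (lemma (∑ n f) (∑ n g) (f n) (g n))
  where
  lemma : ∀ a b c d → a ℤ.+ b ℤ.+ (c ℤ.+ d) ≡ a ℤ.+ c ℤ.+ (b ℤ.+ d)
  lemma = solve-∀

∑-zero : ∀ {m} n {f} → (∀ {k} → k < n → f k ≡ 0ℤ mod m) → ∑ n f ≡ 0ℤ mod m
∑-zero zero    e = mod-refl
∑-zero (suc n) e = +-mod (∑-zero n (λ k<n → e (ℕ.m<n⇒m<1+n k<n))) (e ℕ.≤-refl)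

⋆-binomial : ∀ {m} f g n → (f ⋆ g) n ≡ ∑ (suc n) (λ k → + (n C k) ℤ.* f k ℤ.* g (n ∸ k)) mod m
⋆-binomial f g zero    = mod-reflexive (lemma (f 0) (g 0))
  where
  lemma : ∀ x y → x ℤ.* y ≡ 0ℤ ℤ.+ 1ℤ ℤ.* x ℤ.* y
  lemma = solve-∀
⋆-binomial {m} f g (suc n) = begin
  (D f ⋆ g) n ℤ.+ (f ⋆ D g) n
    ≈⟨ +-mod (⋆-binomial (D f) g n) (⋆-binomial f (D g) n) ⟩
  ∑ (suc n) u ℤ.+ ∑ (suc n) (λ k → + (n C k) ℤ.* f k ℤ.* g (suc (n ∸ k)))
    ≡⟨ cong (λ z → ∑ (suc n) u ℤ.+ z) (∑-front n _) ⟩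
  ∑ (suc n) u ℤ.+ (t₀ ℤ.+ ∑ n (λ k → + (n C suc k) ℤ.* f (suc k) ℤ.* g (suc (n ∸ suc k))))
    ≈⟨ +-mod (mod-refl {x = ∑ (suc n) u}) (+-mod (mod-refl {x = t₀}) (∑-cong n λ {k} k<n → mod-reflexive
         (cong (λ j → + (n C suc k) ℤ.* f (suc k) ℤ.* g j) (sym (ℕ.+-∸-assoc 1 k<n))))) ⟩
  ∑ (suc n) u ℤ.+ (t₀ ℤ.+ ∑ n v)
    ≡⟨ cong (λ z → ∑ (suc n) u ℤ.+ (t₀ ℤ.+ z)) (trans (sym (ℤ.+-identityʳ (∑ n v))) (cong (λ z → ∑ n v ℤ.+ z) (sym v-last))) ⟩
  ∑ (suc n) u ℤ.+ (t₀ ℤ.+ ∑ (suc n) v)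
    ≡⟨ lemma (∑ (suc n) u) t₀ (∑ (suc n) v) ⟩
  t₀ ℤ.+ (∑ (suc n) u ℤ.+ ∑ (suc n) v)
    ≡⟨ cong (λ z → t₀ ℤ.+ z) (sym (∑-+ (suc n) u v)) ⟩
  t₀ ℤ.+ ∑ (suc n) (λ k → u k ℤ.+ v k)
    ≈⟨ +-mod (mod-refl {x = t₀}) (∑-cong (suc n) λ {k} _ → mod-reflexive (pascal k)) ⟩
  t₀ ℤ.+ ∑ (suc n) (λ k → + (suc n C suc k) ℤ.* f (suc k) ℤ.* g (n ∸ k))
    ≡⟨ ∑-front (suc n) (λ k → + (suc n C k) ℤ.* f k ℤ.* g (suc n ∸ k)) ⟨
  ∑ (suc (suc n)) (λ k → + (suc n C k) ℤ.* f k ℤ.* g (suc n ∸ k)) ∎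
  where
  open ≡-mod-Reasoning m
  u v : ℕ → ℤ
  u k = + (n C k) ℤ.* f (suc k) ℤ.* g (n ∸ k)
  v k = + (n C suc k) ℤ.* f (suc k) ℤ.* g (n ∸ k)

  t₀ : ℤ
  t₀ = + (n C 0) ℤ.* f 0 ℤ.* g (suc n)

  lemma : ∀ a b c → a ℤ.+ (b ℤ.+ c) ≡ b ℤ.+ (a ℤ.+ c)
  lemma = solve-∀
  lemma′ : ∀ a b x y → a ℤ.* x ℤ.* y ℤ.+ b ℤ.* x ℤ.* y ≡ (a ℤ.+ b) ℤ.* x ℤ.* y
  lemma′ = solve-∀

  v-last : v n ≡ 0ℤ
  v-last = cong (λ c → + c ℤ.* f (suc n) ℤ.* g (n ∸ n)) (k>n⇒nCk≡0 (ℕ.n<1+n n))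

  pascal : ∀ k → u k ℤ.+ v k ≡ + (suc n C suc k) ℤ.* f (suc k) ℤ.* g (n ∸ k)
  pascal k = trans (lemma′ (+ (n C k)) (+ (n C suc k)) (f (suc k)) (g (n ∸ k)))
    (cong (λ c → + c ℤ.* f (suc k) ℤ.* g (n ∸ k)) (nCk+nC[k+1]≡[n+1]C[k+1] n k))

^-mod : ∀ {m x y} n → x ≡ y mod m → pow x n ≡ pow y n mod m
^-mod zero    e = mod-refl
^-mod (suc n) e = *-mod e (^-mod n e)

-- Fermat's little theorem

prime∣*⇒ : ∀ {p} → Prime p → ∀ x y → + p ∣ x ℤ.* y → (+ p ∣ x) ⊎ (+ p ∣ y)
prime∣*⇒ {p} p-prime x y d with euclidsLemma ℤ.∣ x ∣ ℤ.∣ y ∣ p-prime (subst (p ℕ.∣_) (ℤ.abs-* x y) (∣⇒∣ᵤ d))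
... | inj₁ e = inj₁ (∣ᵤ⇒∣ e)
... | inj₂ e = inj₂ (∣ᵤ⇒∣ e)

prime∤! : ∀ {p} → Prime p → ∀ {k} → k < p → ¬ p ℕ.∣ k !
prime∤! {p} p-prime {zero} _ d = ℕ.<⇒≱ (ℕ.nonTrivial⇒n>1 p) (ℕ.∣⇒≤ d)
  where
  instance
    _ : ℕ.NonTrivial p
    _ = prime⇒nonTrivial p-prime
prime∤! p-prime {suc k} k<p d with euclidsLemma (suc k) (k !) p-prime d
... | inj₁ e = ℕ.<⇒≱ k<p (ℕ.∣⇒≤ e)
... | inj₂ e = prime∤! p-prime (ℕ.<⇒≤ k<p) e

prime∣C : ∀ {p} → Prime p → ∀ {k} → 0 < k → k < p → p ℕ.∣ p C k
prime∣C {p} p-prime {k} 0<k k<p with euclidsLemma (p C k) (k ! ℕ.* (p ∸ k) !) p-prime (subst (p ℕ.∣_) (sym eq) p∣p!)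
  where
  instance
    _ : ℕ.NonZero (k ! ℕ.* (p ∸ k) !)
    _ = k ℕ.!* (p ∸ k) !≢0
    _ : ℕ.NonZero p
    _ = prime⇒nonZero p-prime
  p∣p! : p ℕ.∣ p !
  p∣p! = subst (λ n → p ℕ.∣ n !) (ℕ.suc-pred p) (subst (ℕ._∣ suc (ℕ.pred p) !) (ℕ.suc-pred p) (ℕ.m∣m*n (ℕ.pred p !)))
  eq : (p C k) ℕ.* (k ! ℕ.* (p ∸ k) !) ≡ p !
  eq = trans (cong (ℕ._* (k ! ℕ.* (p ∸ k) !)) (nCk≡n!/k![n-k]! (ℕ.<⇒≤ k<p))) (ℕ.m/n*n≡m (k![n∸k]!∣n! (ℕ.<⇒≤ k<p)))
... | inj₁ d = d
... | inj₂ d with euclidsLemma (k !) ((p ∸ k) !) p-prime d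
...   | inj₁ e = ⊥-elim (prime∤! p-prime k<p e)
...   | inj₂ e = ⊥-elim (prime∤! p-prime (ℕ.∸-monoʳ-< 0<k (ℕ.<⇒≤ k<p)) e)

%ℕ-residue : ∀ x n .{{_ : ℕ.NonZero n}} → x ≡ + (x %ℕ n) mod (+ n)
%ℕ-residue x n = ∣⇒mod (divides (x /ℕ n) (trans (cong (ℤ._- + (x %ℕ n)) (a≡a%ℕn+[a/ℕn]*n x n))
  (lemma (+ (x %ℕ n)) ((x /ℕ n) ℤ.* + n))))
  where
  lemma : ∀ r q → r ℤ.+ q ℤ.- r ≡ q
  lemma = solve-∀

module Fermat (N : ℕ) (p-prime : Prime (suc N)) where

  private
    p = + suc N

  frobenius : ∀ x → pow (1ℤ ℤ.+ x) (suc N) ≡ 1ℤ ℤ.+ pow x (suc N) mod p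
  frobenius x = begin
    pow (1ℤ ℤ.+ x) (suc N)       ≡⟨ pow-⋆-pow 1ℤ x (suc N) ⟨
    (pow 1ℤ ⋆ pow x) (suc N)     ≡⟨ ⋆-comm (pow 1ℤ) (pow x) (suc N) ⟩
    (pow x ⋆ pow 1ℤ) (suc N)     ≈⟨ ⋆-binomial (pow x) (pow 1ℤ) (suc N) ⟩
    ∑ (suc (suc N)) term         ≡⟨ ∑-front (suc N) term ⟩
    term 0 ℤ.+ (∑ N (λ k → term (suc k)) ℤ.+ term (suc N))
      ≈⟨ +-mod (mod-refl {x = term 0}) (+-mod (∑-zero N middle) (mod-refl {x = term (suc N)})) ⟩
    term 0 ℤ.+ (0ℤ ℤ.+ term (suc N))
      ≡⟨ cong₂ (λ a b → a ℤ.+ (0ℤ ℤ.+ b)) first last ⟩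
    1ℤ ℤ.+ (0ℤ ℤ.+ pow x (suc N)) ≡⟨ cong (λ z → 1ℤ ℤ.+ z) (ℤ.+-identityˡ (pow x (suc N))) ⟩
    1ℤ ℤ.+ pow x (suc N)         ∎
    where
    open ≡-mod-Reasoning p
    term : ℕ → ℤ
    term k = + (suc N C k) ℤ.* pow x k ℤ.* pow 1ℤ (suc N ∸ k)

    first : term 0 ≡ 1ℤ
    first = trans (ℤ.*-identityˡ _) (ℤ.^-zeroˡ (suc N))

    last : term (suc N) ≡ pow x (suc N)
    last rewrite nCn≡1 (suc N) | ℕ.n∸n≡0 N = trans (ℤ.*-identityʳ _) (ℤ.*-identityˡ _)

    middle : ∀ {k} → k < N → term (suc k) ≡ 0ℤ mod p
    middle {k} k<N = ∣⇒≡0 (∣m⇒∣m*n _ (∣m⇒∣m*n (pow x (suc k)) (∣ᵤ⇒∣ {p} {+ (suc N C suc k)} (prime∣C p-prime (s≤s z≤n) (s≤s k<N)))))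

  fermat-ℕ : ∀ x → pow (+ x) (suc N) ≡ + x mod p
  fermat-ℕ zero    = mod-refl
  fermat-ℕ (suc x) = mod-trans (frobenius (+ x)) (+-mod (mod-refl {x = 1ℤ}) (fermat-ℕ x))

  fermat : ∀ x → ¬ p ∣ x → pow x N ≡ 1ℤ mod p
  fermat x p∤x = [ (λ d → ⊥-elim (p∤x d)) , ∣⇒mod ]′
    (prime∣*⇒ p-prime x (pow x N ℤ.- 1ℤ) (subst (p ∣_) (lemma x (pow x N)) (divisible x^p≡x)))
    where
    lemma : ∀ x y → x ℤ.* y ℤ.- x ≡ x ℤ.* (y ℤ.- 1ℤ)
    lemma = solve-∀

    x^p≡x : pow x (suc N) ≡ x mod p
    x^p≡x = mod-trans (^-mod (suc N) (%ℕ-residue x (suc N)))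
      (mod-trans (fermat-ℕ (x %ℕ suc N)) (mod-sym (%ℕ-residue x (suc N))))

-- Bernoulli polynomials modulo p

record IsBernoulli (p : ℤ) (N : ℕ) (b : ℕ → ℤ) : Set where
  field
    head-value : b 0 ≡ 1ℤ mod p
    recurrence : ∀ {n} → 0 < n → n < N → ∑ (suc n) (λ k → + (suc n C k) ℤ.* b k) ≡ 0ℤ mod p

module BernoulliPolynomials (p : ℤ) (N : ℕ) (b : ℕ → ℤ) (isBernoulli : IsBernoulli p N b) where

  open IsBernoulli isBernoulli
  open ≡-mod-Reasoning p

  β : ℕ → ℤ → ℤ
  β n x = (b ⋆ pow x) n

  b-⋆-pow1 : ∀ {n} → n ≤ N → (b ⋆ pow 1ℤ) n ≡ b n ℤ.+ δ n mod p
  b-⋆-pow1 {zero}        _   = mod-reflexive (lemma (b 0))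
    where
    lemma : ∀ x → x ℤ.* 1ℤ ≡ x ℤ.+ 0ℤ
    lemma = solve-∀
  b-⋆-pow1 {suc zero}    _   = linear₁ 1ℤ head-value (lemma (b 0) (b 1))
    where
    lemma : ∀ x y → y ℤ.* 1ℤ ℤ.+ x ℤ.* (1ℤ ℤ.* 1ℤ) ℤ.- (y ℤ.+ 1ℤ) ≡ 1ℤ ℤ.* (x ℤ.- 1ℤ)
    lemma = solve-∀
  b-⋆-pow1 {n@(suc (suc n-2))} n≤N = begin
    (b ⋆ pow 1ℤ) n                                        ≈⟨ ⋆-binomial b (pow 1ℤ) n ⟩
    ∑ (suc n) (λ k → + (n C k) ℤ.* b k ℤ.* pow 1ℤ (n ∸ k))
      ≈⟨ ∑-cong (suc n) (λ {k} _ → mod-reflexive (trans (cong (λ z → + (n C k) ℤ.* b k ℤ.* z) (ℤ.^-zeroˡ (n ∸ k))) (ℤ.*-identityʳ (+ (n C k) ℤ.* b k)))) ⟩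
    ∑ n (λ k → + (n C k) ℤ.* b k) ℤ.+ + (n C n) ℤ.* b n   ≈⟨ +-mod (recurrence (s≤s z≤n) n≤N) (mod-reflexive (cong (λ c → + c ℤ.* b n) (nCn≡1 n))) ⟩
    0ℤ ℤ.+ 1ℤ ℤ.* b n                                     ≡⟨ lemma (b n) ⟩
    b n ℤ.+ 0ℤ                                            ∎
    where
    lemma : ∀ x → 0ℤ ℤ.+ 1ℤ ℤ.* x ≡ x ℤ.+ 0ℤ
    lemma = solve-∀

  β-zero : ∀ n → β n 0ℤ ≡ b n
  β-zero n = trans (⋆-comm b (pow 0ℤ) n) (⋆-identityˡ b n)

  β-step : ∀ n x → suc n ≤ N → β (suc n) (1ℤ ℤ.+ x) ≡ β (suc n) x ℤ.+ + suc n ℤ.* pow x n mod p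
  β-step n x n<N = begin
    (b ⋆ pow (1ℤ ℤ.+ x)) (suc n)            ≡⟨ ⋆-cong-≡ (λ _ → refl) (pow-⋆-pow 1ℤ x) (suc n) ⟨
    (b ⋆ (pow 1ℤ ⋆ pow x)) (suc n)          ≡⟨ ⋆-assoc b (pow 1ℤ) (pow x) (suc n) ⟨
    ((b ⋆ pow 1ℤ) ⋆ pow x) (suc n)          ≈⟨ ⋆-cong (suc n) (λ k≤ → b-⋆-pow1 (ℕ.≤-trans k≤ n<N)) (λ _ → mod-refl) ⟩
    ((λ k → b k ℤ.+ δ k) ⋆ pow x) (suc n)   ≡⟨ ⋆-distribˡ b δ (pow x) (suc n) ⟩
    β (suc n) x ℤ.+ (δ ⋆ pow x) (suc n)     ≡⟨ cong (λ z → β (suc n) x ℤ.+ z) (δ-⋆ (pow x) n) ⟩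
    β (suc n) x ℤ.+ + suc n ℤ.* pow x n     ∎

  β-mod : ∀ n {x y} → x ≡ y mod p → β n x ≡ β n y mod p
  β-mod n e = ⋆-cong n (λ _ → mod-refl) (λ {k} _ → ^-mod k e)

  private
    -- d vanishes iff Bₙ(1) = (-1)ⁿ Bₙ.
    d : ℕ → ℤ
    d n = σ b n ℤ.- b n ℤ.- δ n

    σδ : ∀ n → σ δ n ≡ ℤ.- δ n
    σδ zero          = refl
    σδ (suc zero)    = refl
    σδ (suc (suc n)) = ℤ.*-zeroʳ (sgn (suc (suc n)))

    σb-⋆ : ∀ {n} → n ≤ N → (σ b ⋆ pow 1ℤ) n ≡ σ b n ℤ.+ (δ ⋆ pow 1ℤ) n mod p
    σb-⋆ {n} n≤N = linear₁ (ℤ.- 1ℤ) twisted (lemma (σ b n) ((σ b ⋆ pow 1ℤ) n) ((δ ⋆ pow 1ℤ) n))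
      where
      lemma : ∀ s t u → t ℤ.- (s ℤ.+ u) ≡ ℤ.- 1ℤ ℤ.* (s ℤ.- (1ℤ ℤ.* t ℤ.+ ℤ.- 1ℤ ℤ.* u))
      lemma = solve-∀

      expand : ∀ {k} → k ≤ n → (σ b ⋆ pow (ℤ.- 1ℤ)) k ≡ 1ℤ ℤ.* σ b k ℤ.+ ℤ.- 1ℤ ℤ.* δ k mod p
      expand {k} k≤n = begin
        (σ b ⋆ pow (ℤ.- 1ℤ)) k                ≡⟨ ⋆-cong-≡ (λ _ → refl) (σ-pow 1ℤ) k ⟨
        (σ b ⋆ σ (pow 1ℤ)) k                  ≡⟨ σ-⋆ b (pow 1ℤ) k ⟨
        sgn k ℤ.* (b ⋆ pow 1ℤ) k              ≈⟨ *-mod (mod-refl {x = sgn k}) (b-⋆-pow1 (ℕ.≤-trans k≤n n≤N)) ⟩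
        sgn k ℤ.* (b k ℤ.+ δ k)               ≡⟨ ℤ.*-distribˡ-+ (sgn k) (b k) (δ k) ⟩
        σ b k ℤ.+ σ δ k                       ≡⟨ cong₂ ℤ._+_ (sym (ℤ.*-identityˡ (σ b k))) (trans (σδ k) (sym (ℤ.-1*i≡-i (δ k)))) ⟩
        1ℤ ℤ.* σ b k ℤ.+ ℤ.- 1ℤ ℤ.* δ k       ∎

      twisted : σ b n ≡ 1ℤ ℤ.* (σ b ⋆ pow 1ℤ) n ℤ.+ ℤ.- 1ℤ ℤ.* (δ ⋆ pow 1ℤ) n mod p
      twisted = begin
        σ b n                                  ≡⟨ trans (⋆-comm (σ b) (pow 0ℤ) n) (⋆-identityˡ (σ b) n) ⟨
        (σ b ⋆ pow 0ℤ) n                       ≡⟨ ⋆-cong-≡ (λ _ → refl) (pow-⋆-pow (ℤ.- 1ℤ) 1ℤ) n ⟨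
        (σ b ⋆ (pow (ℤ.- 1ℤ) ⋆ pow 1ℤ)) n      ≡⟨ ⋆-assoc (σ b) (pow (ℤ.- 1ℤ)) (pow 1ℤ) n ⟨
        ((σ b ⋆ pow (ℤ.- 1ℤ)) ⋆ pow 1ℤ) n      ≈⟨ ⋆-cong n expand (λ _ → mod-refl) ⟩
        ((λ k → 1ℤ ℤ.* σ b k ℤ.+ ℤ.- 1ℤ ℤ.* δ k) ⋆ pow 1ℤ) n
                                               ≡⟨ ⋆-linearˡ 1ℤ (ℤ.- 1ℤ) (σ b) δ (pow 1ℤ) n ⟩
        1ℤ ℤ.* (σ b ⋆ pow 1ℤ) n ℤ.+ ℤ.- 1ℤ ℤ.* (δ ⋆ pow 1ℤ) n ∎

    d-⋆ : ∀ {n} → n ≤ N → (d ⋆ pow 1ℤ) n ≡ d n mod p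
    d-⋆ {n} n≤N = begin
      (d ⋆ pow 1ℤ) n
        ≡⟨ ⋆-cong-≡ (λ k → lemma₁ (σ b k) (b k) (δ k)) (λ _ → refl) n ⟩
      ((λ k → 1ℤ ℤ.* σ b k ℤ.+ ℤ.- 1ℤ ℤ.* (b k ℤ.+ δ k)) ⋆ pow 1ℤ) n
        ≡⟨ ⋆-linearˡ 1ℤ (ℤ.- 1ℤ) (σ b) (λ k → b k ℤ.+ δ k) (pow 1ℤ) n ⟩
      1ℤ ℤ.* (σ b ⋆ pow 1ℤ) n ℤ.+ ℤ.- 1ℤ ℤ.* ((λ k → b k ℤ.+ δ k) ⋆ pow 1ℤ) n
        ≡⟨ cong (λ z → 1ℤ ℤ.* (σ b ⋆ pow 1ℤ) n ℤ.+ ℤ.- 1ℤ ℤ.* z) (⋆-distribˡ b δ (pow 1ℤ) n) ⟩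
      1ℤ ℤ.* (σ b ⋆ pow 1ℤ) n ℤ.+ ℤ.- 1ℤ ℤ.* ((b ⋆ pow 1ℤ) n ℤ.+ (δ ⋆ pow 1ℤ) n)
        ≈⟨ linear₂ 1ℤ (ℤ.- 1ℤ) (σb-⋆ n≤N) (b-⋆-pow1 n≤N)
             (lemma₂ (σ b n) (b n) (δ n) ((σ b ⋆ pow 1ℤ) n) ((b ⋆ pow 1ℤ) n) ((δ ⋆ pow 1ℤ) n)) ⟩
      d n ∎
      where
      lemma₁ : ∀ s b d → s ℤ.- b ℤ.- d ≡ 1ℤ ℤ.* s ℤ.+ ℤ.- 1ℤ ℤ.* (b ℤ.+ d)
      lemma₁ = solve-∀
      lemma₂ : ∀ s b d s′ b′ d′ → 1ℤ ℤ.* s′ ℤ.+ ℤ.- 1ℤ ℤ.* (b′ ℤ.+ d′) ℤ.- (s ℤ.- b ℤ.- d) ≡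
        1ℤ ℤ.* (s′ ℤ.- (s ℤ.+ d′)) ℤ.+ ℤ.- 1ℤ ℤ.* (b′ ℤ.- (b ℤ.+ d))
      lemma₂ = solve-∀

  module _ (inv : ℕ → ℤ) (inv-law : ∀ {k} → k < N → + suc k ℤ.* inv k ≡ 1ℤ mod p) where

    private
      d-vanishes : ∀ n → n ≤ N → ∀ {k} → k < n → d k ≡ 0ℤ mod p
      d-vanishes (suc n) n<N {k} (s≤s k≤n) with ℕ.m≤n⇒m<n∨m≡n k≤n
      ... | inj₁ k<n  = d-vanishes n (ℕ.<⇒≤ n<N) k<n
      ... | inj₂ refl = *-cancel-unit {u = + suc n} (inv-law n<N)
        (linear₂ 1ℤ (ℤ.- 1ℤ) (d-⋆ n<N) (⋆-leading d (pow 1ℤ) n (d-vanishes n (ℕ.<⇒≤ n<N)))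
          (lemma (+ suc n) (d n) (d (suc n)) ((d ⋆ pow 1ℤ) (suc n))))
        where
        lemma : ∀ n d d′ t → n ℤ.* d ℤ.- 0ℤ ≡
          1ℤ ℤ.* (t ℤ.- d′) ℤ.+ ℤ.- 1ℤ ℤ.* (t ℤ.- (n ℤ.* (d ℤ.* 1ℤ) ℤ.+ d′ ℤ.* 1ℤ))
        lemma = solve-∀

    odd-bernoulli : ∀ {n u} → + 2 ℤ.* u ≡ 1ℤ mod p → 1 < n → n < N → sgn n ≡ ℤ.- 1ℤ → b n ≡ 0ℤ mod p
    odd-bernoulli {suc (suc n)} {u} unit _ n<N odd = *-cancel-unit {u = + 2} unit
      (linear₁ (ℤ.- 1ℤ) (d-vanishes N ℕ.≤-refl n<N)
        (trans (lemma (b (suc (suc n)))) (cong (λ s → ℤ.- 1ℤ ℤ.* (s ℤ.* b (suc (suc n)) ℤ.- b (suc (suc n)) ℤ.- 0ℤ ℤ.- 0ℤ)) (sym odd))))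
      where
      lemma : ∀ b → + 2 ℤ.* b ℤ.- 0ℤ ≡ ℤ.- 1ℤ ℤ.* (ℤ.- 1ℤ ℤ.* b ℤ.- b ℤ.- 0ℤ ℤ.- 0ℤ)
      lemma = solve-∀
    odd-bernoulli {suc zero} _ (s≤s ()) _ _

module BernoulliModPrime
  (L : ℕ) (1≤L : 1 ≤ L) (p-prime : Prime (3 ℕ.+ L))
  (sgn-even : sgn (2 ℕ.+ L) ≡ 1ℤ)
  (b : ℕ → ℤ) (isBernoulli : IsBernoulli (+ (3 ℕ.+ L)) (2 ℕ.+ L) b)
  (inv : ℕ → ℤ) (inv-law : ∀ {k} → k < 2 ℕ.+ L → + suc k ℤ.* inv k ≡ 1ℤ mod (+ (3 ℕ.+ L)))
  where

  private
    N : ℕ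
    N = 2 ℕ.+ L

    p : ℤ
    p = + suc N

  open BernoulliPolynomials p N b isBernoulli
  open Harmonic inv using (h; h₂)
  open Fermat N p-prime using (fermat)
  open ≡-mod-Reasoning p

  private
    half : + 2 ℤ.* inv 1 ≡ 1ℤ mod p
    half = inv-law (s≤s (s≤s z≤n))

    fermat< : ∀ {k} → k < N → pow (+ suc k) N ≡ 1ℤ mod p
    fermat< {k} k<N = fermat (+ suc k) (λ d → ℕ.<⇒≱ (s≤s k<N) (ℕ.∣⇒≤ (∣⇒∣ᵤ d)))

    p≡0 : p ≡ 0ℤ mod p
    p≡0 = ∣⇒≡0 ∣-refl

  inv-pow : ∀ {k} → k < N → pow (+ suc k) (suc L) ≡ inv k mod p
  inv-pow {k} k<N = inverse-unique {u = + suc k} (fermat< k<N) (inv-law k<N)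

  inv²-pow : ∀ {k} → k < N → pow (+ suc k) L ≡ inv k ℤ.* inv k mod p
  inv²-pow {k} k<N = inverse-unique {u = + suc k ℤ.* + suc k}
    (mod-trans (mod-reflexive (ℤ.*-assoc (+ suc k) (+ suc k) (pow (+ suc k) L))) (fermat< k<N))
    (mod-trans (mod-reflexive (lemma (+ suc k) (inv k))) (*-mod (inv-law k<N) (inv-law k<N)))
    where
    lemma : ∀ x i → x ℤ.* x ℤ.* (i ℤ.* i) ≡ x ℤ.* i ℤ.* (x ℤ.* i)
    lemma = solve-∀

  bernoulli-p-2 : b (suc L) ≡ 0ℤ mod p
  bernoulli-p-2 = odd-bernoulli inv inv-law half (s≤s 1≤L) ℕ.≤-refl
    (trans (sym (ℤ.neg-involutive (sgn (suc L)))) (cong ℤ.-_ sgn-even))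

  β-p-2 : ∀ s → s ≤ N → β (suc L) (+ suc s) ≡ ℤ.- + 2 ℤ.* h₂ s mod p
  β-p-2 zero    _   = begin
    β (suc L) 1ℤ                              ≈⟨ β-step L 0ℤ (ℕ.n≤1+n (suc L)) ⟩
    β (suc L) 0ℤ ℤ.+ + suc L ℤ.* pow 0ℤ L     ≡⟨ cong₂ (λ x y → x ℤ.+ + suc L ℤ.* y) (β-zero (suc L)) pow-0-L ⟩
    b (suc L) ℤ.+ + suc L ℤ.* 0ℤ              ≈⟨ +-mod bernoulli-p-2 (mod-reflexive (ℤ.*-zeroʳ (+ suc L))) ⟩
    0ℤ                                        ∎
    where
    pow-0-L : pow 0ℤ L ≡ 0ℤ
    pow-0-L = trans (cong (pow 0ℤ) (sym (ℕ.suc-pred L {{ℕ.>-nonZero 1≤L}}))) refl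
  β-p-2 (suc s) s<N = begin
    β (suc L) (+ suc (suc s))                                ≈⟨ β-step L (+ suc s) (ℕ.n≤1+n (suc L)) ⟩
    β (suc L) (+ suc s) ℤ.+ + suc L ℤ.* pow (+ suc s) L
      ≈⟨ linear₃ 1ℤ (+ suc L) (inv s ℤ.* inv s) (β-p-2 s (ℕ.<⇒≤ s<N)) (inv²-pow s<N) p≡0
           (lemma (β (suc L) (+ suc s)) (+ suc L) (pow (+ suc s) L) (h₂ s) (inv s)) ⟩
    ℤ.- + 2 ℤ.* h₂ (suc s)                                   ∎
    where
    lemma : ∀ β l q h i → β ℤ.+ l ℤ.* q ℤ.- ℤ.- + 2 ℤ.* (h ℤ.+ i ℤ.* i) ≡
      1ℤ ℤ.* (β ℤ.- ℤ.- + 2 ℤ.* h) ℤ.+ l ℤ.* (q ℤ.- i ℤ.* i) ℤ.+ (i ℤ.* i) ℤ.* (+ 2 ℤ.+ l ℤ.- 0ℤ)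
    lemma = solve-∀

  β-p-1 : ∀ s → s ≤ N → β N (+ suc s) ≡ b N ℤ.- h s mod p
  β-p-1 zero    _   = begin
    β N 1ℤ                                    ≈⟨ β-step (suc L) 0ℤ ℕ.≤-refl ⟩
    β N 0ℤ ℤ.+ + N ℤ.* 0ℤ                     ≡⟨ cong₂ ℤ._+_ (β-zero N) (ℤ.*-zeroʳ (+ N)) ⟩
    b N ℤ.+ 0ℤ                                ∎
  β-p-1 (suc s) s<N = begin
    β N (+ suc (suc s))                                      ≈⟨ β-step (suc L) (+ suc s) ℕ.≤-refl ⟩
    β N (+ suc s) ℤ.+ + N ℤ.* pow (+ suc s) (suc L)
      ≈⟨ linear₃ 1ℤ (+ N) (inv s) (β-p-1 s (ℕ.<⇒≤ s<N)) (inv-pow s<N) p≡0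
           (lemma (β N (+ suc s)) (b N) (+ N) (pow (+ suc s) (suc L)) (h s) (inv s)) ⟩
    b N ℤ.- h (suc s)                                        ∎
    where
    lemma : ∀ β b n q h i → β ℤ.+ n ℤ.* q ℤ.- (b ℤ.- (h ℤ.+ i)) ≡
      1ℤ ℤ.* (β ℤ.- (b ℤ.- h)) ℤ.+ n ℤ.* (q ℤ.- i) ℤ.+ i ℤ.* (1ℤ ℤ.+ n ℤ.- 0ℤ)
    lemma = solve-∀

  h₂-vanishes : h₂ N ≡ 0ℤ mod p
  h₂-vanishes = *-cancel-unit {u = + 2} half (linear₂ 1ℤ (ℤ.- 1ℤ) (β-p-2 N ℕ.≤-refl) β[p]≡0 (lemma (β (suc L) p) (h₂ N)))
    where
    lemma : ∀ β h → + 2 ℤ.* h ℤ.- 0ℤ ≡ 1ℤ ℤ.* (β ℤ.- ℤ.- + 2 ℤ.* h) ℤ.+ ℤ.- 1ℤ ℤ.* (β ℤ.- 0ℤ)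
    lemma = solve-∀

    β[p]≡0 : β (suc L) p ≡ 0ℤ mod p
    β[p]≡0 = begin
      β (suc L) p    ≈⟨ β-mod (suc L) p≡0 ⟩
      β (suc L) 0ℤ   ≡⟨ β-zero (suc L) ⟩
      b (suc L)      ≈⟨ bernoulli-p-2 ⟩
      0ℤ             ∎

-- Residues of p-adic numbers modulo p²

↥-/-cross : ∀ i n .{{_ : ℕ.NonZero n}} → ↥ (i ℚ./ n) ℤ.* + n ≡ i ℤ.* ↧ (i ℚ./ n)
↥-/-cross i n = begin
  ↥ (i ℚ./ n) ℤ.* + n                            ≡⟨ cong (λ z → ↥ (i ℚ./ n) ℤ.* z) (ℚ.↧-/ i n) ⟨
  ↥ (i ℚ./ n) ℤ.* (↧ (i ℚ./ n) ℤ.* gcd i (+ n))  ≡⟨ lemma (↥ (i ℚ./ n)) (↧ (i ℚ./ n)) (gcd i (+ n)) ⟩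
  ↥ (i ℚ./ n) ℤ.* gcd i (+ n) ℤ.* ↧ (i ℚ./ n)    ≡⟨ cong (λ z → z ℤ.* ↧ (i ℚ./ n)) (ℚ.↥-/ i n) ⟩
  i ℤ.* ↧ (i ℚ./ n)                              ∎
  where
  open ≡-Reasoning
  lemma : ∀ a b g → a ℤ.* (b ℤ.* g) ≡ a ℤ.* g ℤ.* b
  lemma = solve-∀

∏ : ℕ → (ℕ → ℤ) → ℤ
∏ zero    f = 1ℤ
∏ (suc n) f = ∏ n f ℤ.* f n

∏-front : ∀ n f → ∏ (suc n) f ≡ f 0 ℤ.* ∏ n (λ k → f (suc k))
∏-front zero    f = ℤ.*-comm 1ℤ (f 0)
∏-front (suc n) f = trans (cong (ℤ._* f (suc n)) (∏-front n f))
  (ℤ.*-assoc (f 0) (∏ n (λ k → f (suc k))) (f (suc n)))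

∏-const : ∀ n x → ∏ n (λ _ → x) ≡ pow x n
∏-const zero    x = refl
∏-const (suc n) x = trans (∏-front n (λ _ → x)) (cong (x ℤ.*_) (∏-const n x))

-- Stated over an abstract monoid so that its operation does not unfold during type checking.
module RelatedFolds
  (M : RawMonoid 0ℓ 0ℓ)
  (_⊕_ : ℤ → ℤ → ℤ) (z : ℤ) (fold : ℕ → (ℕ → ℤ) → ℤ)
  (fold-zero : ∀ f → fold 0 f ≡ z)
  (fold-front : ∀ n f → fold (suc n) f ≡ f 0 ⊕ fold n (λ k → f (suc k)))
  (P Q : RawMonoid.Carrier M → ℤ → Set)
  (step : ∀ x y i j → P x i → Q y j → Q (RawMonoid._∙_ M x y) (i ⊕ j))
  where

  open RawMonoid M
  open RawMonoidDefinitions M using (sum) renaming (_×_ to _·_)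

  sum-related : ∀ n {f : Fin n → Carrier} {g} → Q ε z → (∀ i → P (f i) (g (toℕ i))) → Q (sum f) (fold n g)
  sum-related zero    {f} {g} b e = subst (Q ε) (sym (fold-zero g)) b
  sum-related (suc n) {f} {g} b e =
    subst (Q (sum f)) (sym (fold-front n g)) (step _ _ _ _ (e zero) (sum-related n b (λ i → e (suc i))))

  sum-related-last : ∀ {m} n {f : Fin m → Carrier} {g} → m ≡ suc n →
    (∀ i → toℕ i ≡ n → Q (f i ∙ ε) z) → (∀ i → toℕ i < n → P (f i) (g (toℕ i))) → Q (sum f) (fold n g)
  sum-related-last zero    {f} {g} refl b e = subst (Q (f zero ∙ ε)) (sym (fold-zero g)) (b zero refl)
  sum-related-last (suc n) {f} {g} refl b e =
    subst (Q _) (sym (fold-front n g)) (step _ _ _ _ (e zero (s≤s z≤n))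
      (sum-related-last n refl (λ i i≡n → b (suc i) (cong suc i≡n)) (λ i i<n → e (suc i) (s≤s i<n))))

  ×-related : ∀ n {x i} → Q ε z → P x i → Q (n · x) (fold n (λ _ → i))
  ×-related zero    {x} {i} b e = subst (Q ε) (sym (fold-zero _)) b
  ×-related (suc n) {x} {i} b e = subst (Q (x ∙ (n · x))) (sym (fold-front n _)) (step _ _ _ _ e (×-related n b e))

module Residues (p : ℕ) (p-prime : Prime p) where

  open Padic p p-prime

  private
    instance
      p≢0 : ℕ.NonZero p
      p≢0 = prime⇒nonZero p-prime

  p^-suc : ∀ n → p^ (suc n) ≡ + p ℤ.* p^ n
  p^-suc n = ℤ.pos-* p (p ℕ.^ n)

  p^1≡p : p^ 1 ≡ + p
  p^1≡p = cong +_ (ℕ.*-identityʳ p)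

  p^-∣ : ∀ {m n} → m ≤ n → p^ m ∣ p^ n
  p^-∣ {m} {n} m≤n = divides (p^ (n ∸ m))
    (trans (cong p^ (sym (ℕ.m∸n+n≡m m≤n))) (trans (cong +_ (ℕ.^-distribˡ-+-* p (n ∸ m) m)) (ℤ.pos-* (p ℕ.^ (n ∸ m)) (p ℕ.^ m))))

  at-coherent : ∀ x m n → x at (m ℕ.+ n) ≡ x at n mod (p^ n)
  at-coherent x zero    n = mod-refl
  at-coherent x (suc m) n = mod-trans (mod-weaken (p^-∣ (ℕ.m≤n+m n m)) (∣⇒mod (coherent x (m ℕ.+ n)))) (at-coherent x m n)

  mod-p^0 : ∀ x y → x ≡ y mod (p^ 0)
  mod-p^0 x y = ∣⇒mod (divides (x ℤ.- y) (sym (ℤ.*-identityʳ _)))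

  ∣⇒mod-p^ : ∀ n {x y} → + p ℤ.* p^ n ∣ x ℤ.- y → x ≡ y mod (p^ (suc n))
  ∣⇒mod-p^ n d = ∣⇒mod (subst (_∣ _) (sym (p^-suc n)) d)

  -- Hensel lifting of the inverse y of x modulo p: here 1 - x ⋅ lift x y n = (1 - x ⋅ y)ⁿ.
  lift : ℤ → ℤ → ℕ → ℤ
  lift x y zero    = 0ℤ
  lift x y (suc n) = lift x y n ℤ.+ y ℤ.* (1ℤ ℤ.- x ℤ.* lift x y n)

  lift-inverse : ∀ {x y} n → x ℤ.* y ≡ 1ℤ mod (+ p) → x ℤ.* lift x y n ≡ 1ℤ mod (p^ n)
  lift-inverse {x} {y} zero    e = mod-p^0 (x ℤ.* lift x y 0) 1ℤ
  lift-inverse {x} {y} (suc n) e with divisible e | divisible (lift-inverse {x} {y} n e)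
  ... | divides q eq | divides q′ eq′ = ∣⇒mod-p^ n (divides (ℤ.- (q ℤ.* q′))
    (trans (lemma x y (lift x y n)) (trans (cong₂ (λ a b → ℤ.- (a ℤ.* b)) eq eq′) (lemma′ q q′ (+ p) (p^ n)))))
    where
    lemma : ∀ x y z → x ℤ.* (z ℤ.+ y ℤ.* (1ℤ ℤ.- x ℤ.* z)) ℤ.- 1ℤ ≡ ℤ.- ((x ℤ.* y ℤ.- 1ℤ) ℤ.* (x ℤ.* z ℤ.- 1ℤ))
    lemma = solve-∀
    lemma′ : ∀ q q′ p r → ℤ.- (q ℤ.* p ℤ.* (q′ ℤ.* r)) ≡ ℤ.- (q ℤ.* q′) ℤ.* (p ℤ.* r)
    lemma′ = solve-∀

  Unit : ℤₚ → Set
  Unit x = ¬ p^ 1 ∣ x at 1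

  inverseAt : ℤ → ℤ → ℕ → ℤ
  inverseAt x₁ x n = lift x (pow x₁ (p ∸ 2)) n

  private
    inverse-law-at : ∀ x → Unit x → ∀ n → x at n ℤ.* inverseAt (x at 1) (x at n) n ≡ 1ℤ mod (p^ n)
    inverse-law-at x u zero    = mod-p^0 (x at 0 ℤ.* 0ℤ) 1ℤ
    inverse-law-at x u (suc n) = lift-inverse {x at suc n} {pow (x at 1) (p ∸ 2)} (suc n)
      (mod-trans (*-mod x≡ (mod-refl {x = pow (x at 1) (p ∸ 2)})) x^)
      where
      x≡ : x at suc n ≡ x at 1 mod (+ p)
      x≡ = subst (x at suc n ≡ x at 1 mod_) p^1≡p
        (subst (λ k → x at k ≡ x at 1 mod (p^ 1)) (ℕ.+-comm n 1) (at-coherent x n 1))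

      fermat : ∀ k (k-prime : Prime k) → ¬ + k ∣ x at 1 → x at 1 ℤ.* pow (x at 1) (k ∸ 2) ≡ 1ℤ mod (+ k)
      fermat zero          k-prime = ⊥-elim (ℕ.≢-nonZero⁻¹ 0 {{prime⇒nonZero k-prime}} refl)
      fermat (suc zero)    k-prime = ⊥-elim (ℕ.<-irrefl refl (ℕ.nonTrivial⇒n>1 1 {{prime⇒nonTrivial k-prime}}))
      fermat (suc (suc k)) k-prime = Fermat.fermat (suc k) k-prime (x at 1)

      x^ : x at 1 ℤ.* pow (x at 1) (p ∸ 2) ≡ 1ℤ mod (+ p)
      x^ = fermat p p-prime (u ∘ subst (_∣ x at 1) (sym p^1≡p))

  inverse : (x : ℤₚ) → Unit x → ℤₚ
  inverse x u at n = inverseAt (x at 1) (x at n) n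
  coherent (inverse x u) n = divisible (inverse-unique {u = x at n}
    (mod-trans (*-mod (mod-sym (at-coherent x 1 n)) (mod-refl {x = inverseAt (x at 1) (x at suc n) (suc n)}))
      (mod-weaken (p^-∣ (ℕ.n≤1+n n)) (inverse-law-at x u (suc n))))
    (inverse-law-at x u n))

  inverse-law : ∀ x u n → x at n ℤ.* inverse x u at n ≡ 1ℤ mod (p^ n)
  inverse-law = inverse-law-at

  *ᶻ-cancelˡ : ∀ c x y → c #0 → (∀ n → c at n ℤ.* x at n ≡ c at n ℤ.* y at n mod (p^ n)) →
               ∀ n → x at n ≡ y at n mod (p^ n)
  *ᶻ-cancelˡ c x y c#0 e n with p^ n ∣? x at n ℤ.- y at n
  ... | yes d = ∣⇒mod d
  ... | no ¬d with *-#0 {c} {x -ᶻ y} c#0 (n , ¬d)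
  ...   | m , ¬cd = ⊥-elim (¬cd (subst (p^ m ∣_) (lemma (c at m) (x at m) (y at m)) (divisible (e m))))
    where
    lemma : ∀ c x y → c ℤ.* x ℤ.- c ℤ.* y ≡ c ℤ.* (x ℤ.- y)
    lemma = solve-∀

  -- The fraction ν/δ is a p-adic integer with residue i modulo p².
  record Residue (ν δ : ℕ → ℤ) (i : ℤ) : Set where
    constructor mk∼
    field
      value   : ℤₚ
      isValue : ∀ n → ν n ≡ value at n ℤ.* δ n mod (p^ n)
      residue : value at 2 ≡ i mod (p^ 2)

  infix 4 _∼_

  -- Stated through the representing sequences, so that the type checker never
  -- compares the coherence proofs inside X.
  _∼_ : ℚₚ → ℤ → Set
  X ∼ i = Residue (num X at_) (den X at_) i

  ∼-resp : ∀ {ν δ i j} → Residue ν δ i → i ≡ j mod (p^ 2) → Residue ν δ j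
  ∼-resp (mk∼ u e r) i≡j = mk∼ u e (mod-trans r i≡j)

  ∼-resp-≡ : ∀ {ν δ i j} → Residue ν δ i → i ≡ j → Residue ν δ j
  ∼-resp-≡ X∼i refl = X∼i

  ∼-+ : ∀ {ν δ ν′ δ′ i j} → Residue ν δ i → Residue ν′ δ′ j →
        Residue (λ n → ν n ℤ.* δ′ n ℤ.+ ν′ n ℤ.* δ n) (λ n → δ n ℤ.* δ′ n) (i ℤ.+ j)
  ∼-+ {ν} {δ} {ν′} {δ′} (mk∼ u e r) (mk∼ v f s) = mk∼ (u +ᶻ v)
    (λ n → linear₂ (δ′ n) (δ n) (e n) (f n) (lemma (ν n) (δ n) (ν′ n) (δ′ n) (u at n) (v at n)))
    (+-mod r s)
    where
    lemma : ∀ a b c d u v → a ℤ.* d ℤ.+ c ℤ.* b ℤ.- (u ℤ.+ v) ℤ.* (b ℤ.* d) ≡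
      d ℤ.* (a ℤ.- u ℤ.* b) ℤ.+ b ℤ.* (c ℤ.- v ℤ.* d)
    lemma = solve-∀

  ∼-* : ∀ {ν δ ν′ δ′ i j} → Residue ν δ i → Residue ν′ δ′ j →
        Residue (λ n → ν n ℤ.* ν′ n) (λ n → δ n ℤ.* δ′ n) (i ℤ.* j)
  ∼-* {ν} {δ} {ν′} {δ′} (mk∼ u e r) (mk∼ v f s) = mk∼ (u *ᶻ v)
    (λ n → linear₂ (ν′ n) (u at n ℤ.* δ n) (e n) (f n) (lemma (ν n) (δ n) (ν′ n) (δ′ n) (u at n) (v at n)))
    (*-mod r s)
    where
    lemma : ∀ a b c d u v → a ℤ.* c ℤ.- u ℤ.* v ℤ.* (b ℤ.* d) ≡
      c ℤ.* (a ℤ.- u ℤ.* b) ℤ.+ (u ℤ.* b) ℤ.* (c ℤ.- v ℤ.* d)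
    lemma = solve-∀

  ∼-neg : ∀ {ν δ i} → Residue ν δ i → Residue (λ n → ℤ.- ν n) δ (ℤ.- i)
  ∼-neg {ν} {δ} (mk∼ u e r) = mk∼ (-ᶻ u)
    (λ n → linear₁ (ℤ.- 1ℤ) (e n) (lemma (ν n) (δ n) (u at n))) (neg-mod r)
    where
    lemma : ∀ a b u → ℤ.- a ℤ.- ℤ.- u ℤ.* b ≡ ℤ.- 1ℤ ℤ.* (a ℤ.- u ℤ.* b)
    lemma = solve-∀

  ∼-ι : ∀ x → ι x ∼ x at 2
  ∼-ι x = mk∼ x (λ n → mod-reflexive (sym (ℤ.*-identityʳ (x at n)))) mod-refl

  ∼-1/ : ∀ x {i} → Unit x → x at 2 ℤ.* i ≡ 1ℤ mod (p^ 2) → Residue (λ _ → 1ℤ) (x at_) i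
  ∼-1/ x u e = mk∼ (inverse x u)
    (λ n → mod-sym (mod-trans (mod-reflexive (ℤ.*-comm (inverse x u at n) (x at n))) (inverse-law x u n)))
    (inverse-unique {u = x at 2} (inverse-law x u 2) e)

  private
    module ℚₚ-Raw = RawRing ℚₚ-rawRing
    module Sum = RelatedFolds ℚₚ-Raw.+-rawMonoid ℤ._+_ 0ℤ ∑ (λ _ → refl) ∑-front _∼_ _∼_ (λ _ _ _ _ → ∼-+)
    module Product = RelatedFolds ℚₚ-Raw.*-rawMonoid ℤ._*_ 1ℤ ∏ (λ _ → refl) ∏-front _∼_ _∼_ (λ _ _ _ _ → ∼-*)

  ∼-sum : ∀ n {f : Fin n → ℚₚ} {g} → (∀ i → f i ∼ g (toℕ i)) → sum f ∼ ∑ n g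
  ∼-sum n {f} = Sum.sum-related n {f} (∼-ι 0ᶻ)

  ∼-product : ∀ n {f : Fin n → ℚₚ} {g} → (∀ i → f i ∼ g (toℕ i)) → product f ∼ ∏ n g
  ∼-product n {f} = Product.sum-related n {f} (∼-ι 1ᶻ)

  ∼-^ : ∀ {X i} → X ∼ i → ∀ n → X ^ n ∼ pow i n
  ∼-^ {X} {i} e n = ∼-resp-≡ (Product.×-related n {X} (∼-ι 1ᶻ) e) (∏-const n i)

  private
    Near : ℚₚ → ℚₚ → ℤ → Set
    Near Y X i = X - Y ∼ i

    near-+0 : ∀ Y X {i} → Near Y X i → Near Y (X + ι 0ᶻ) i
    near-+0 Y X (mk∼ u e r) =
      mk∼ u (λ n → linear₁ 1ℤ (e n) (lemma (num X at n) (den X at n) (num Y at n) (den Y at n) (u at n))) r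
      where
      lemma : ∀ a b c d u → (a ℤ.* 1ℤ ℤ.+ 0ℤ ℤ.* b) ℤ.* d ℤ.+ ℤ.- c ℤ.* (b ℤ.* 1ℤ) ℤ.- u ℤ.* (b ℤ.* 1ℤ ℤ.* d) ≡
        1ℤ ℤ.* (a ℤ.* d ℤ.+ ℤ.- c ℤ.* b ℤ.- u ℤ.* (b ℤ.* d))
      lemma = solve-∀

    near-+ : ∀ Y A R i j → A ∼ i → Near Y R j → Near Y (A + R) (i ℤ.+ j)
    near-+ Y A R i j (mk∼ u e r) (mk∼ v f s) = mk∼ (u +ᶻ v)
      (λ n → linear₂ (den R at n ℤ.* den Y at n) (den A at n) (e n) (f n)
        (lemma (num A at n) (den A at n) (num R at n) (den R at n) (num Y at n) (den Y at n) (u at n) (v at n)))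
      (+-mod r s)
      where
      lemma : ∀ a b c d y z u v →
        (a ℤ.* d ℤ.+ c ℤ.* b) ℤ.* z ℤ.+ ℤ.- y ℤ.* (b ℤ.* d) ℤ.- (u ℤ.+ v) ℤ.* (b ℤ.* d ℤ.* z) ≡
        (d ℤ.* z) ℤ.* (a ℤ.- u ℤ.* b) ℤ.+ b ℤ.* (c ℤ.* z ℤ.+ ℤ.- y ℤ.* d ℤ.- v ℤ.* (d ℤ.* z))
      lemma = solve-∀

    module NearSum (Y : ℚₚ) =
      RelatedFolds ℚₚ-Raw.+-rawMonoid ℤ._+_ 0ℤ ∑ (λ _ → refl) ∑-front _∼_ (Near Y) (near-+ Y)

  -- The last term need not be integral, only its difference with Y.
  ∼-sum-diff : ∀ {m} n {f : Fin m → ℚₚ} {g} Y → m ≡ suc n →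
    (∀ i → toℕ i ≡ n → f i - Y ∼ 0ℤ) → (∀ i → toℕ i < n → f i ∼ g (toℕ i)) → sum f - Y ∼ ∑ n g
  ∼-sum-diff n {f} Y m≡ b e = NearSum.sum-related-last Y n m≡ (λ i i≡n → near-+0 Y (f i) (b i i≡n)) e

  ∼-unique : ∀ {X i j} → X ∼ i → X ∼ j → i ≡ j mod (p^ 2)
  ∼-unique {X} (mk∼ u e r) (mk∼ v f s) = mod-trans (mod-sym r) (mod-trans
    (*ᶻ-cancelˡ (den X) u v (den-#0 X) (λ n → mod-trans (mod-reflexive (ℤ.*-comm (den X at n) (u at n)))
      (mod-trans (mod-sym (e n)) (mod-trans (f n) (mod-reflexive (ℤ.*-comm (v at n) (den X at n)))))) 2) s)

  -- X ≡ Y mod-p^ k, in terms of the fractions representing X and Y.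
  Congruent : (ν δ ν′ δ′ : ℕ → ℤ) → ℕ → Set
  Congruent ν δ ν′ δ′ k = Σ (ℤₚ × ℤₚ) λ (u , v) →
    (∀ n → p^ n ∣ ν n ℤ.* 1ℤ ℤ.- u at n ℤ.* δ n) × (∀ n → p^ n ∣ ν′ n ℤ.* 1ℤ ℤ.- v at n ℤ.* δ′ n) × u ≡ v modᶻ-p^ k

  ∼⇒congruent : ∀ {ν δ ν′ δ′ i j} k → k ≤ 2 → Residue ν δ i → Residue ν′ δ′ j → i ≡ j mod (p^ k) → Congruent ν δ ν′ δ′ k
  ∼⇒congruent {ν} {δ} {ν′} {δ′} k k≤2 (mk∼ u e r) (mk∼ v f s) i≡j =
    (u , v) , cross {ν} {δ} u e , cross {ν′} {δ′} v f , (z , λ n → divisible (u≡v+p^kz n))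
    where
    cross : ∀ {ν δ} u → (∀ n → ν n ≡ u at n ℤ.* δ n mod (p^ n)) → ∀ n → p^ n ∣ ν n ℤ.* 1ℤ ℤ.- u at n ℤ.* δ n
    cross {ν} {δ} u e n = divisible (mod-trans (mod-reflexive (ℤ.*-identityʳ (ν n))) (e n))

    instance
      _ : ℤ.NonZero (p^ k)
      _ = ℕ.m^n≢0 p k

    at-2 : ∀ x → x at 2 ≡ x at k mod (p^ k)
    at-2 x = subst (λ m → x at m ≡ x at k mod (p^ k)) (ℕ.m∸n+n≡m k≤2) (at-coherent x (2 ∸ k) k)

    difference : ∀ n → u at (n ℕ.+ k) ≡ v at (n ℕ.+ k) mod (p^ k)
    difference n = mod-trans (at-coherent u n k) (mod-trans (mod-sym (at-2 u))
      (mod-trans (mod-weaken (p^-∣ k≤2) r) (mod-trans i≡j (mod-trans (mod-sym (mod-weaken (p^-∣ k≤2) s))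
        (mod-trans (at-2 v) (mod-sym (at-coherent v n k)))))))

    q : ℕ → ℤ
    q n = quotient (divisible (difference n))

    q-law : ∀ n → u at (n ℕ.+ k) ℤ.- v at (n ℕ.+ k) ≡ q n ℤ.* p^ k
    q-law n = _∣_.equality (divisible (difference n))

    z : ℤₚ
    z at n = q n
    coherent z n = *-cancelʳ-∣ (p^ k) (subst₂ _∣_
      (trans (cong +_ (ℕ.^-distribˡ-+-* p n k)) (ℤ.pos-* (p ℕ.^ n) (p ℕ.^ k)))
      (trans (lemma (u at (suc n ℕ.+ k)) (u at (n ℕ.+ k)) (v at (suc n ℕ.+ k)) (v at (n ℕ.+ k)))
        (trans (cong₂ ℤ._-_ (q-law (suc n)) (q-law n)) (lemma′ (q (suc n)) (q n) (p^ k))))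
      (∣m∣n⇒∣m-n (coherent u (n ℕ.+ k)) (coherent v (n ℕ.+ k))))
      where
      lemma : ∀ a b c d → (a ℤ.- b) ℤ.- (c ℤ.- d) ≡ (a ℤ.- c) ℤ.- (b ℤ.- d)
      lemma = solve-∀
      lemma′ : ∀ a b c → a ℤ.* c ℤ.- b ℤ.* c ≡ (a ℤ.- b) ℤ.* c
      lemma′ = solve-∀

    u≡v+p^kz : ∀ n → u at n ≡ v at n ℤ.+ p^ k ℤ.* q n mod (p^ n)
    u≡v+p^kz n = linear₂ (ℤ.- 1ℤ) 1ℤ (lower u) (lower v)
      (trans (lemma (u at n) (v at n) (u at (n ℕ.+ k)) (v at (n ℕ.+ k)) (p^ k ℤ.* q n))
        (trans (cong (λ d → rest ℤ.+ (d ℤ.- p^ k ℤ.* q n)) (q-law n)) (lemma′ rest (q n) (p^ k))))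
      where
      rest : ℤ
      rest = ℤ.- 1ℤ ℤ.* (u at (n ℕ.+ k) ℤ.- u at n) ℤ.+ 1ℤ ℤ.* (v at (n ℕ.+ k) ℤ.- v at n)
      lower : ∀ x → x at (n ℕ.+ k) ≡ x at n mod (p^ n)
      lower x = subst (λ m → x at m ≡ x at n mod (p^ n)) (ℕ.+-comm k n) (at-coherent x k n)
      lemma : ∀ a b c d e → a ℤ.- (b ℤ.+ e) ≡ (ℤ.- 1ℤ ℤ.* (c ℤ.- a) ℤ.+ 1ℤ ℤ.* (d ℤ.- b)) ℤ.+ ((c ℤ.- d) ℤ.- e)
      lemma = solve-∀
      lemma′ : ∀ r q c → r ℤ.+ (q ℤ.* c ℤ.- c ℤ.* q) ≡ r
      lemma′ = solve-∀

  module _ (i : ℤ) (n : ℕ) .{{n≢0 : ℕ.NonZero n}} where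

    ∼-/ : ∀ {j} u → (∀ m → i ≡ u at m ℤ.* + n mod (p^ m)) → u at 2 ≡ j mod (p^ 2) → fromℚ (i ℚ./ n) ∼ j
    ∼-/ u e r = mk∼ u
      (*ᶻ-cancelˡ (fromℤ (+ n)) (fromℤ (↥ (i ℚ./ n))) (u *ᶻ fromℤ (↧ (i ℚ./ n))) (fromℕ-#0 n)
        (λ m → linear₁ (↧ (i ℚ./ n)) (e m) (trans (cong (ℤ._- (+ n ℤ.* (u at m ℤ.* ↧ (i ℚ./ n)))) (trans (ℤ.*-comm (+ n) (↥ (i ℚ./ n))) (↥-/-cross i n)))
          (lemma i (+ n) (↧ (i ℚ./ n)) (u at m)))))
      r
      where
      lemma : ∀ i n d u → i ℤ.* d ℤ.- n ℤ.* (u ℤ.* d) ≡ d ℤ.* (i ℤ.- u ℤ.* n)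
      lemma = solve-∀

  ∼-ℚ-integer : ∀ i → fromℚ (i ℚ./ 1) ∼ i
  ∼-ℚ-integer i = ∼-/ i 1 (fromℤ i) (λ _ → mod-reflexive (sym (ℤ.*-identityʳ i))) mod-refl

  ∼-ℚ-reciprocal : ∀ n .{{_ : ℕ.NonZero n}} {j} → Unit (fromℤ (+ n)) → + n ℤ.* j ≡ 1ℤ mod (p^ 2) → fromℚ (1ℤ ℚ./ n) ∼ j
  ∼-ℚ-reciprocal n u e = ∼-/ 1ℤ n (inverse (fromℤ (+ n)) u)
    (λ m → mod-sym (mod-trans (mod-reflexive (ℤ.*-comm (inverse (fromℤ (+ n)) u at m) (+ n))) (inverse-law (fromℤ (+ n)) u m)))
    (inverse-unique {u = + n} (inverse-law (fromℤ (+ n)) u 2) e)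

  ∼-ℚ-+ : ∀ {a b i j} → fromℚ a ∼ i → fromℚ b ∼ j → fromℚ (a ℚ.+ b) ∼ i ℤ.+ j
  ∼-ℚ-+ {a@record{}} {b@record{}} (mk∼ u e r) (mk∼ v f s) = ∼-/ (↥ a ℤ.* ↧ b ℤ.+ ↥ b ℤ.* ↧ a) (↧ₙ a ℕ.* ↧ₙ b) (u +ᶻ v)
    (λ m → linear₂ (↧ b) (↧ a) (e m) (f m) (trans
      (cong (λ z → ↥ a ℤ.* ↧ b ℤ.+ ↥ b ℤ.* ↧ a ℤ.- (u at m ℤ.+ v at m) ℤ.* z) (ℤ.pos-* (↧ₙ a) (↧ₙ b)))
      (lemma (↥ a) (↧ a) (↥ b) (↧ b) (u at m) (v at m))))
    (+-mod r s)
    where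
    lemma : ∀ a b c d u v → a ℤ.* d ℤ.+ c ℤ.* b ℤ.- (u ℤ.+ v) ℤ.* (b ℤ.* d) ≡
      d ℤ.* (a ℤ.- u ℤ.* b) ℤ.+ b ℤ.* (c ℤ.- v ℤ.* d)
    lemma = solve-∀

  ∼-ℚ-* : ∀ {a b i j} → fromℚ a ∼ i → fromℚ b ∼ j → fromℚ (a ℚ.* b) ∼ i ℤ.* j
  ∼-ℚ-* {a@record{}} {b@record{}} (mk∼ u e r) (mk∼ v f s) = ∼-/ (↥ a ℤ.* ↥ b) (↧ₙ a ℕ.* ↧ₙ b) (u *ᶻ v)
    (λ m → linear₂ (↥ b) (u at m ℤ.* ↧ a) (e m) (f m) (trans
      (cong (λ z → ↥ a ℤ.* ↥ b ℤ.- u at m ℤ.* v at m ℤ.* z) (ℤ.pos-* (↧ₙ a) (↧ₙ b)))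
      (lemma (↥ a) (↧ a) (↥ b) (↧ b) (u at m) (v at m))))
    (*-mod r s)
    where
    lemma : ∀ a b c d u v → a ℤ.* c ℤ.- u ℤ.* v ℤ.* (b ℤ.* d) ≡
      c ℤ.* (a ℤ.- u ℤ.* b) ℤ.+ (u ℤ.* b) ℤ.* (c ℤ.- v ℤ.* d)
    lemma = solve-∀

  ∼-ℚ-neg : ∀ {a i} → fromℚ a ∼ i → fromℚ (ℚ.- a) ∼ ℤ.- i
  ∼-ℚ-neg {a} (mk∼ u e r) = mk∼ (-ᶻ u)
    (λ n → linear₁ (ℤ.- 1ℤ) (e n) (trans (cong₂ (λ x y → x ℤ.- ℤ.- (u at n) ℤ.* y) (ℚ.↥-neg a) (ℚ.↧-neg a))
      (lemma (↥ a) (↧ a) (u at n))))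
    (neg-mod r)
    where
    lemma : ∀ a b u → ℤ.- a ℤ.- ℤ.- u ℤ.* b ≡ ℤ.- 1ℤ ℤ.* (a ℤ.- u ℤ.* b)
    lemma = solve-∀

  ∼-ℚ-sum : ∀ n {f : Fin n → ℚ} {g} → (∀ i → fromℚ (f i) ∼ g (toℕ i)) →
            fromℚ (RawMonoidDefinitions.sum ℚ.+-0-rawMonoid f) ∼ ∑ n g
  ∼-ℚ-sum n {f} = RelatedFolds.sum-related ℚ.+-0-rawMonoid ℤ._+_ 0ℤ ∑ (λ _ → refl) ∑-front
    (λ a → fromℚ a ∼_) (λ a → fromℚ a ∼_) (λ a b _ _ → ∼-ℚ-+ {a} {b}) n {f} (∼-ℚ-integer 0ℤ)

sum-cong-≡ : ∀ n {f g : Fin n → ℚ} → (∀ i → f i ≡ g i) →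
  RawMonoidDefinitions.sum ℚ.+-0-rawMonoid f ≡ RawMonoidDefinitions.sum ℚ.+-0-rawMonoid g
sum-cong-≡ zero    e = refl
sum-cong-≡ (suc n) e = cong₂ ℚ._+_ (e zero) (sum-cong-≡ n (e ∘ suc))

B-unfold : ∀ n → B n ≡ B-step n (λ {k} _ → B k)
B-unfold n = WellFounded.FixPoint.unfold-wfRec <-wellFounded (λ _ → ℚ) B-step ext {n}
  where
  ext : ∀ n {f g : ∀ {k} → k < n → ℚ} → (∀ {k} (k<n : k < n) → f k<n ≡ g k<n) → B-step n f ≡ B-step n g
  ext zero    e = refl
  ext (suc n) e = cong (ℚ.- (1ℤ ℚ./ suc (suc n)) ℚ.*_)
    (sum-cong-≡ (suc n) (λ i → cong ((+ (suc (suc n) C toℕ i) ℚ./ 1) ℚ.*_) (e (toℕ<n i))))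

choose-below : ∀ {P : ℕ → ℤ → Set} n → (∀ {k} → k < n → ∃ (P k)) →
  ∃ λ g → (∀ {k} → k < n → P k (g k)) × (∀ {k} → n ≤ k → g k ≡ 0ℤ)
choose-below {P} n e = (λ k → pick (k ℕ.<? n)) , (λ {k} → below (k ℕ.<? n)) , (λ {k} → above (k ℕ.<? n))
  where
  pick : ∀ {k} → Dec (k < n) → ℤ
  pick (yes k<n) = proj₁ (e k<n)
  pick (no _)    = 0ℤ

  below : ∀ {k} (d : Dec (k < n)) → k < n → P k (pick d)
  below (yes k<n) _   = proj₂ (e k<n)
  below (no k≮n)  k<n = ⊥-elim (k≮n k<n)

  above : ∀ {k} (d : Dec (k < n)) → n ≤ k → pick d ≡ 0ℤ
  above (yes k<n) n≤k = ⊥-elim (ℕ.<⇒≱ k<n n≤k)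
  above (no _)    _   = refl

pow-neg-one : ∀ n → pow (ℤ.- 1ℤ) n ≡ sgn n
pow-neg-one zero    = refl
pow-neg-one (suc n) = trans (ℤ.-1*i≡-i _) (cong ℤ.-_ (pow-neg-one n))

module Terms (p : ℕ) (p-prime : Prime p) where

  open Padic p p-prime
  open Residues p p-prime

  inv : ℕ → ℤ
  inv k = inverseAt (+ suc k) (+ suc k) 2

  open Harmonic inv using (h; w; S)

  unit-suc : ∀ {k} → suc k < p → Unit (fromℤ (+ suc k))
  unit-suc {k} k<p d = ℕ.<⇒≱ k<p (ℕ.∣⇒≤ (∣⇒∣ᵤ (subst (_∣ + suc k) p^1≡p d)))

  inv-law : ∀ {k} → suc k < p → + suc k ℤ.* inv k ≡ 1ℤ mod (p^ 2)
  inv-law {k} k<p = inverse-law (fromℤ (+ suc k)) (unit-suc k<p) 2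

  ∼-reciprocal : ∀ {k} → suc k < p → fromℚ (1ℤ ℚ./ suc k) ∼ inv k
  ∼-reciprocal {k} k<p = ∼-ℚ-reciprocal (suc k) (unit-suc k<p) (inv-law k<p)

  ∼-H : ∀ {n} → n < p → fromℚ (H n) ∼ h n
  ∼-H {n} n<p = ∼-ℚ-sum n (λ i → ∼-reciprocal (ℕ.≤-<-trans (toℕ<n i) n<p))

  factorial-inverse : ∀ k → k < p → + (k !) ℤ.* ∏ k inv ≡ 1ℤ mod (p^ 2)
  factorial-inverse zero    _   = mod-refl
  factorial-inverse (suc k) k<p = mod-trans
    (mod-reflexive (trans (cong (ℤ._* (∏ k inv ℤ.* inv k)) (ℤ.pos-* (suc k) (k !))) (lemma (+ suc k) (+ (k !)) (∏ k inv) (inv k))))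
    (*-mod (inv-law k<p) (factorial-inverse k (ℕ.<⇒≤ k<p)))
    where
    lemma : ∀ a b c d → a ℤ.* b ℤ.* (c ℤ.* d) ≡ a ℤ.* d ℤ.* (b ℤ.* c)
    lemma = solve-∀

  ∼-1/! : ∀ {k} → k < p → fromℚ ((1ℤ ℚ./ (k !)) {{k ℕ.!≢0}}) ∼ ∏ k inv
  ∼-1/! {k} k<p = ∼-ℚ-reciprocal (k !) {{k ℕ.!≢0}}
    (λ d → prime∤! p-prime k<p (∣⇒∣ᵤ (subst (_∣ + (k !)) p^1≡p d))) (factorial-inverse k k<p)

  binom-w : ∀ α k → (∏ k (λ j → ℤ.- α ℤ.- + j) ℤ.* ∏ k inv) ℤ.* (∏ k (λ j → (α ℤ.- 1ℤ) ℤ.- + j) ℤ.* ∏ k inv) ≡ w (α ℤ.- 1ℤ) k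
  binom-w α zero    = refl
  binom-w α (suc k) = trans
    (lemma α (+ k) (∏ k (λ j → ℤ.- α ℤ.- + j)) (∏ k (λ j → (α ℤ.- 1ℤ) ℤ.- + j)) (∏ k inv) (inv k))
    (cong (λ z → z ℤ.* (+ k ℤ.* + suc k ℤ.- (α ℤ.- 1ℤ) ℤ.* (1ℤ ℤ.+ (α ℤ.- 1ℤ))) ℤ.* (inv k ℤ.* inv k)) (binom-w α k))
    where
    lemma : ∀ α k a b c i →
      a ℤ.* (ℤ.- α ℤ.- k) ℤ.* (c ℤ.* i) ℤ.* (b ℤ.* ((α ℤ.- 1ℤ) ℤ.- k) ℤ.* (c ℤ.* i)) ≡
      a ℤ.* c ℤ.* (b ℤ.* c) ℤ.* (k ℤ.* (1ℤ ℤ.+ k) ℤ.- (α ℤ.- 1ℤ) ℤ.* (1ℤ ℤ.+ (α ℤ.- 1ℤ))) ℤ.* (i ℤ.* i)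
    lemma = solve-∀

  ∼-summand : ∀ α k → k < p → {f g : Fin k → ℚₚ} →
    (∀ i → f i ∼ ℤ.- α ℤ.- + toℕ i) → (∀ i → g i ∼ (α ℤ.- 1ℤ) ℤ.- + toℕ i) →
    let q = (1ℤ ℚ./ (k !)) {{k ℕ.!≢0}} in
    Residue (λ n → (num (product f) at n ℤ.* ↥ q) ℤ.* (num (product g) at n ℤ.* ↥ q) ℤ.* ↥ (H k))
            (λ n → (den (product f) at n ℤ.* ↧ q) ℤ.* (den (product g) at n ℤ.* ↧ q) ℤ.* ↧ (H k))
            (w (α ℤ.- 1ℤ) k ℤ.* h k)
  ∼-summand α k k<p f∼ g∼ = ∼-*
    (∼-resp-≡ (∼-* (∼-* (∼-product k f∼) (∼-1/! k<p)) (∼-* (∼-product k g∼) (∼-1/! k<p))) (binom-w α k))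
    (∼-H k<p)

  ∼-sign : ∀ {X} n → X ∼ ℤ.- 1ℤ → X ^ n ∼ sgn n
  ∼-sign n e = ∼-resp-≡ (∼-^ e n) (pow-neg-one n)

  ∼-sum-0< : ∀ n {f : ∀ k → k < n → ℚₚ} {g} → (∀ i (i<n : suc i < n) → f (suc i) i<n ∼ g i) → sum-0< n f ∼ ∑ (n ∸ 1) g
  ∼-sum-0< zero    e = ∼-ι 0ᶻ
  ∼-sum-0< (suc n) e = ∼-sum n (λ i → e (toℕ i) (s≤s (toℕ<n i)))

  private
    bernoulli-sum : ∀ {b : ℕ → ℤ} n → (∀ {k} → k < suc n → fromℚ (B k) ∼ b k) → suc (suc n) < p →
      fromℚ (B (suc n)) ∼ ℤ.- inv (suc n) ℤ.* ∑ (suc n) (λ k → + (suc (suc n) C k) ℤ.* b k)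
    bernoulli-sum {b} n e n<p = subst (λ q → fromℚ q ∼ ℤ.- inv (suc n) ℤ.* ∑ (suc n) (λ k → + (suc (suc n) C k) ℤ.* b k)) (sym (B-unfold (suc n)))
      (∼-ℚ-* {ℚ.- (1ℤ ℚ./ suc (suc n))} {RawMonoidDefinitions.sum ℚ.+-0-rawMonoid {suc n} (λ i → (+ (suc (suc n) C toℕ i) ℚ./ 1) ℚ.* B (toℕ i))} (∼-ℚ-neg {1ℤ ℚ./ suc (suc n)} (∼-reciprocal n<p))
        (∼-ℚ-sum (suc n) {λ i → (+ (suc (suc n) C toℕ i) ℚ./ 1) ℚ.* B (toℕ i)} {λ k → + (suc (suc n) C k) ℤ.* b k}
          (λ i → ∼-ℚ-* {+ (suc (suc n) C toℕ i) ℚ./ 1} {B (toℕ i)} (∼-ℚ-integer (+ (suc (suc n) C toℕ i))) (e {toℕ i} (toℕ<n i)))))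

    B-integral : ∀ n → suc n < p → ∃ (fromℚ (B n) ∼_)
    B-integral = <-rec (λ n → suc n < p → ∃ (fromℚ (B n) ∼_)) step
      where
      step : ∀ n → (∀ {k} → k < n → suc k < p → ∃ (fromℚ (B k) ∼_)) → suc n < p → ∃ (fromℚ (B n) ∼_)
      step zero    _  _   = 1ℤ , ∼-ℚ-integer 1ℤ
      step (suc n) ih n<p with choose-below {λ k → fromℚ (B k) ∼_} (suc n) (λ k<n → ih k<n (ℕ.<-trans (s≤s k<n) n<p))
      ... | b , law , _ = _ , bernoulli-sum {b} n (λ {k} → law {k}) n<p

  module BernoulliResidues (N : ℕ) (N<p : N < p) where

    private
      chosen = choose-below {λ k → fromℚ (B k) ∼_} N (λ k<N → B-integral _ (ℕ.≤-<-trans k<N N<p))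

    -- Residues of the Bernoulli numbers below index N, and 0 from N on.
    b : ℕ → ℤ
    b = proj₁ chosen

    ∼-B : ∀ {k} → k < N → fromℚ (B k) ∼ b k
    ∼-B = proj₁ (proj₂ chosen)

    b-above : ∀ {k} → N ≤ k → b k ≡ 0ℤ
    b-above = proj₂ (proj₂ chosen)

    b-zero : 0 < N → b 0 ≡ 1ℤ mod (p^ 2)
    b-zero 0<N = ∼-unique {fromℚ (B 0)} (∼-B {0} 0<N) (∼-ℚ-integer 1ℤ)

    b-recurrence : ∀ {n} → 0 < n → n < N → ∑ (suc n) (λ k → + (suc n C k) ℤ.* b k) ≡ 0ℤ mod (p^ 2)
    b-recurrence {suc n} _ n<N = mod-trans
      (mod-reflexive (cong (λ c → Σb ℤ.+ + c ℤ.* b (suc n)) last-coefficient))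
      (linear₂ (+ suc (suc n)) (ℤ.- Σb)
        (∼-unique {fromℚ (B (suc n))} (∼-B {suc n} n<N) (bernoulli-sum {b} n (λ {k} k<n → ∼-B {k} (ℕ.<-trans k<n n<N)) n<p)) (inv-law n<p)
        (lemma (+ suc (suc n)) (inv (suc n)) (b (suc n)) Σb))
      where
      Σb : ℤ
      Σb = ∑ (suc n) (λ k → + (suc (suc n) C k) ℤ.* b k)

      n<p : suc (suc n) < p
      n<p = ℕ.≤-<-trans n<N N<p

      last-coefficient : suc (suc n) C suc n ≡ suc (suc n)
      last-coefficient = trans (nCk≡nC[n∸k] (ℕ.n≤1+n (suc n)))
        (trans (cong (suc (suc n) C_) (ℕ.m+n∸n≡m 1 (suc n))) (nC1≡n (suc (suc n))))

      lemma : ∀ n i b s → s ℤ.+ n ℤ.* b ℤ.- 0ℤ ≡ n ℤ.* (b ℤ.- ℤ.- i ℤ.* s) ℤ.+ ℤ.- s ℤ.* (n ℤ.* i ℤ.- 1ℤ)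
      lemma = solve-∀

    private
      term : ℤ → ℕ → ℕ → ℤ
      term α n k = + (n C k) ℤ.* b k ℤ.* pow α (n ∸ k)

    ∼-Bₚ-term : ∀ {X α} n {k} → k < N → X ∼ α →
      let q = (+ (n C k) ℚ./ 1) ℚ.* B k in
      Residue (λ m → ↥ q ℤ.* num (X ^ (n ∸ k)) at m) (λ m → ↧ q ℤ.* den (X ^ (n ∸ k)) at m) (term α n k)
    ∼-Bₚ-term n {k} k<N e = ∼-* (∼-ℚ-* {+ (n C k) ℚ./ 1} {B k} (∼-ℚ-integer (+ (n C k))) (∼-B k<N)) (∼-^ e (n ∸ k))

    ∼-Bₚ : ∀ {ν δ ν′ δ′} α n → Residue ν δ (term α n 0) → Residue ν′ δ′ (∑ n (λ k → term α n (suc k))) →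
      Residue (λ m → ν m ℤ.* δ′ m ℤ.+ ν′ m ℤ.* δ m) (λ m → δ m ℤ.* δ′ m) ((b ⋆ pow α) n)
    ∼-Bₚ α n e e′ = ∼-resp (∼-resp-≡ (∼-+ e e′) (sym (∑-front n (term α n)))) (mod-sym (⋆-binomial b (pow α) n))

    -- Its coefficient is B N, which need not be p-integral.
    ∼-Bₚ-last-term : ∀ {X k} → k ≡ N →
      let q = (+ (N C k) ℚ./ 1) ℚ.* B k in
      Residue (λ m → (↥ q ℤ.* num (X ^ (N ∸ k)) at m) ℤ.* ↧ (B N) ℤ.+ ℤ.- ↥ (B N) ℤ.* (↧ q ℤ.* den (X ^ (N ∸ k)) at m))
              (λ m → (↧ q ℤ.* den (X ^ (N ∸ k)) at m) ℤ.* ↧ (B N)) 0ℤ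
    ∼-Bₚ-last-term {X} refl = general _ _
      (trans (cong (λ c → (+ c ℚ./ 1) ℚ.* B N) (nCn≡1 N)) (ℚ.*-identityˡ (B N))) (ℕ.n∸n≡0 N)
      where
      lemma : ∀ q d → q ℤ.* 1ℤ ℤ.* d ℤ.+ ℤ.- q ℤ.* (d ℤ.* 1ℤ) ≡ 0ℤ ℤ.* (d ℤ.* 1ℤ ℤ.* d)
      lemma = solve-∀

      general : ∀ q j → q ≡ B N → j ≡ 0 →
        Residue (λ m → (↥ q ℤ.* num (X ^ j) at m) ℤ.* ↧ (B N) ℤ.+ ℤ.- ↥ (B N) ℤ.* (↧ q ℤ.* den (X ^ j) at m))
                (λ m → (↧ q ℤ.* den (X ^ j) at m) ℤ.* ↧ (B N)) 0ℤ
      general q _ refl refl = mk∼ 0ᶻ (λ _ → mod-reflexive (lemma (↥ q) (↧ q))) mod-refl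

    ∼-Bₚ-diff : ∀ {ν δ} α n {f : Fin N → ℚₚ} → N ≡ suc n → Residue ν δ (term α N 0) →
      (∀ i → toℕ i ≡ n → f i - fromℚ (B N) ∼ 0ℤ) → (∀ i → toℕ i < n → f i ∼ term α N (suc (toℕ i))) →
      Residue (λ m → (ν m ℤ.* den (sum f) at m ℤ.+ num (sum f) at m ℤ.* δ m) ℤ.* ↧ (B N)
                       ℤ.+ ℤ.- ↥ (B N) ℤ.* (δ m ℤ.* den (sum f) at m))
              (λ m → (δ m ℤ.* den (sum f) at m) ℤ.* ↧ (B N))
              ((b ⋆ pow α) N)
    ∼-Bₚ-diff {ν} {δ} α n {f} N≡ e last∼ f∼ = ∼-resp
      (add {num (sum f) at_} {den (sum f) at_} {↥ (B N)} {↧ (B N)} e (∼-sum-diff n {f} {λ k → term α N (suc k)} (fromℚ (B N)) N≡ last∼ f∼))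
      (mod-trans (mod-reflexive total) (mod-sym (⋆-binomial b (pow α) N)))
      where
      lemma : ∀ a b c d y z u v →
        (a ℤ.* d ℤ.+ c ℤ.* b) ℤ.* z ℤ.+ ℤ.- y ℤ.* (b ℤ.* d) ℤ.- (u ℤ.+ v) ℤ.* (b ℤ.* d ℤ.* z) ≡
        (d ℤ.* z) ℤ.* (a ℤ.- u ℤ.* b) ℤ.+ b ℤ.* (c ℤ.* z ℤ.+ ℤ.- y ℤ.* d ℤ.- v ℤ.* (d ℤ.* z))
      lemma = solve-∀

      add : ∀ {ν′ δ′ y z i j} → Residue ν δ i → Residue (λ m → ν′ m ℤ.* z ℤ.+ ℤ.- y ℤ.* δ′ m) (λ m → δ′ m ℤ.* z) j →
        Residue (λ m → (ν m ℤ.* δ′ m ℤ.+ ν′ m ℤ.* δ m) ℤ.* z ℤ.+ ℤ.- y ℤ.* (δ m ℤ.* δ′ m))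
                (λ m → (δ m ℤ.* δ′ m) ℤ.* z) (i ℤ.+ j)
      add {ν′} {δ′} {y} {z} (mk∼ u e r) (mk∼ v e′ r′) = mk∼ (u +ᶻ v)
        (λ m → linear₂ (δ′ m ℤ.* z) (δ m) (e m) (e′ m) (lemma (ν m) (δ m) (ν′ m) (δ′ m) y z (u at m) (v at m)))
        (+-mod r r′)

      lemma′ : ∀ s c x → s ≡ s ℤ.+ c ℤ.* 0ℤ ℤ.* x
      lemma′ = solve-∀

      total : term α N 0 ℤ.+ ∑ n (λ k → term α N (suc k)) ≡ ∑ (suc N) (term α N)
      total = trans (sym (∑-front n (term α N))) (trans (cong (λ m → ∑ m (term α N)) (sym N≡))
        (trans (lemma′ (∑ N (term α N)) (+ (N C N)) (pow α (N ∸ N)))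
          (cong (λ z → ∑ N (term α N) ℤ.+ + (N C N) ℤ.* z ℤ.* pow α (N ∸ N)) (sym (b-above ℕ.≤-refl)))))

<-residue-unique : ∀ {p x y} → x < p → y < p → + x ≡ + y mod (+ p) → x ≡ y
<-residue-unique {p} x<p y<p e = ℕ.≤-antisym (bound x<p e) (bound y<p (mod-sym e))
  where
  bound : ∀ {x y} → x < p → + x ≡ + y mod (+ p) → x ≤ y
  bound {x} {y} x<p (∣⇒mod d) with ℕ.≤-total x y
  ... | inj₁ x≤y = x≤y
  ... | inj₂ y≤x with x ∸ y in eq | subst (+ p ∣_) (trans (ℤ.m-n≡m⊖n x y) (ℤ.⊖-≥ y≤x)) d
  ...   | zero  | _  = ℕ.m∸n≡0⇒m≤n eq
  ...   | suc k | d′ = ⊥-elim (ℕ.<⇒≱ (ℕ.≤-<-trans (ℕ.m∸n≤m x y) x<p) (subst (p ≤_) (sym eq) (ℕ.∣⇒≤ (∣⇒∣ᵤ d′))))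

sgn-parity : ∀ n → sgn n ≡ 1ℤ ⊎ 2 ℕ.∣ suc n
sgn-parity zero          = inj₁ refl
sgn-parity (suc zero)    = inj₂ ℕ.∣-refl
sgn-parity (suc (suc n)) with sgn-parity n
... | inj₁ e = inj₁ (trans (ℤ.neg-involutive (sgn n)) e)
... | inj₂ d = inj₂ (ℕ.∣m∣n⇒∣m+n ℕ.∣-refl d)

∑-reverse : ∀ n f → ∑ n (λ i → f (n ∸ suc i)) ≡ ∑ n f
∑-reverse zero    f = refl
∑-reverse (suc n) f = trans (∑-front n (λ i → f (n ∸ i)))
  (trans (ℤ.+-comm (f n) (∑ n (λ i → f (n ∸ suc i)))) (cong (ℤ._+ f n) (∑-reverse n f)))

module Congruences
  (l : ℕ) (p-prime : Prime (4 ℕ.+ l))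
  (inv : ℕ → ℤ) (inv-law : ∀ {k} → k < 3 ℕ.+ l → + suc k ℤ.* inv k ≡ 1ℤ mod (+ ((4 ℕ.+ l) ℕ.^ 2)))
  (b : ℕ → ℤ) (b-zero : b 0 ≡ 1ℤ mod (+ ((4 ℕ.+ l) ℕ.^ 2)))
  (b-recurrence : ∀ {n} → 0 < n → n < 3 ℕ.+ l → ∑ (suc n) (λ k → + (suc n C k) ℤ.* b k) ≡ 0ℤ mod (+ ((4 ℕ.+ l) ℕ.^ 2)))
  (b-last : b (3 ℕ.+ l) ≡ 0ℤ)
  (α : ℤ) (s : ℕ) (s≤N : s ≤ 3 ℕ.+ l) (t : ℤ) (α-1≡ : α ℤ.- 1ℤ ≡ + s ℤ.+ t ℤ.* + (4 ℕ.+ l))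
  where

  open Harmonic inv

  private
    N : ℕ
    N = 3 ℕ.+ l

    p p² : ℤ
    p  = + suc N
    p² = + (suc N ℕ.^ 2)

    p*p≡p² : p ℤ.* p ≡ p²
    p*p≡p² = trans (sym (ℤ.pos-* (suc N) (suc N))) (cong (λ z → + (suc N ℕ.* z)) (sym (ℕ.*-identityʳ (suc N))))

    p∣p² : p ∣ p²
    p∣p² = subst (p ∣_) p*p≡p² (∣m⇒∣m*n p ∣-refl)

    to-p² : ∀ {x y} → x ≡ y mod (p ℤ.* p) → x ≡ y mod p²
    to-p² = mod-weaken (subst (_∣ p ℤ.* p) p*p≡p² ∣-refl)

    from-p² : ∀ {x y} → x ≡ y mod p² → x ≡ y mod (p ℤ.* p)
    from-p² = mod-weaken (subst (p ℤ.* p ∣_) p*p≡p² ∣-refl)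

    sgnN : sgn N ≡ 1ℤ
    sgnN with sgn-parity N
    ... | inj₁ e = e
    ... | inj₂ d with prime⇒irreducible p-prime d
    ...   | inj₁ ()
    ...   | inj₂ ()

    isBernoulli : IsBernoulli p N b
    isBernoulli = record
      { head-value = mod-weaken p∣p² b-zero
      ; recurrence = λ 0<n n<N → mod-weaken p∣p² (b-recurrence 0<n n<N)
      }

    module Mod-p = BernoulliModPrime (suc l) (s≤s z≤n) p-prime sgnN b isBernoulli
      inv (λ k<N → mod-weaken p∣p² (inv-law k<N))

    module Mod-p² = Supercongruence inv N (λ k<N → from-p² (inv-law k<N))

    hN≡0 : h N ≡ 0ℤ mod (p ℤ.* p)
    hN≡0 = Mod-p².wolstenholme {inv 1} (from-p² (inv-law (s≤s (s≤s z≤n)))) Mod-p.h₂-vanishes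

    S≡ : S (suc N) (α ℤ.- 1ℤ) ≡ sgn s ℤ.* (+ 2 ℤ.* (h s ℤ.- t ℤ.* p ℤ.* h₂ s)) mod (p ℤ.* p)
    S≡ = subst (λ x → S (suc N) x ≡ sgn s ℤ.* (+ 2 ℤ.* (h s ℤ.- t ℤ.* p ℤ.* h₂ s)) mod (p ℤ.* p)) (sym α-1≡)
      (Mod-p².supercongruence hN≡0 sgnN s s≤N t)

    α≡ : α ≡ + suc s mod p
    α≡ = ∣⇒mod (divides t (trans (lemma α (+ s)) (trans (cong (ℤ._- + s) α-1≡) (lemma′ (+ s) (t ℤ.* p)))))
      where
      lemma : ∀ α s → α ℤ.- (1ℤ ℤ.+ s) ≡ α ℤ.- 1ℤ ℤ.- s
      lemma = solve-∀
      lemma′ : ∀ s q → s ℤ.+ q ℤ.- s ≡ q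
      lemma′ = solve-∀

    α-eq : ∀ x → α ℤ.- x ≡ 1ℤ ℤ.+ (+ s ℤ.+ t ℤ.* p) ℤ.- x
    α-eq x = trans (lemma α x) (cong (λ z → 1ℤ ℤ.+ z ℤ.- x) α-1≡)
      where
      lemma : ∀ α x → α ℤ.- x ≡ 1ℤ ℤ.+ (α ℤ.- 1ℤ) ℤ.- x
      lemma = solve-∀

    β : ℕ → ℤ
    β n = (b ⋆ pow α) n

    pβ≡ : p ℤ.* β (2 ℕ.+ l) ≡ p ℤ.* (ℤ.- + 2 ℤ.* h₂ s) mod (p ℤ.* p)
    pβ≡ = scale-mod p (mod-trans (⋆-cong (2 ℕ.+ l) (λ _ → mod-refl) (λ {k} _ → ^-mod k α≡)) (Mod-p.β-p-2 s s≤N))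

    ph₂N≡0 : p ℤ.* h₂ N ≡ 0ℤ mod (p ℤ.* p)
    ph₂N≡0 = mod-trans (scale-mod p Mod-p.h₂-vanishes) (mod-reflexive (ℤ.*-zeroʳ p))

    β-last : β N ≡ ℤ.- h s mod p
    β-last = mod-trans (⋆-cong N (λ _ → mod-refl) (λ {k} _ → ^-mod k α≡))
      (mod-trans (Mod-p.β-p-1 s s≤N) (mod-reflexive (trans (cong (ℤ._- h s) b-last) (ℤ.+-identityˡ (ℤ.- h s)))))

  -- 1/(j+1+tp) modulo p², expanded to first order in tp.
  shifted : ℕ → ℤ
  shifted j = inv j ℤ.- t ℤ.* p ℤ.* (inv j ℤ.* inv j)

  shifted-inverse : ∀ {i} → i < s → (α ℤ.- + suc i) ℤ.* shifted (s ∸ suc i) ≡ 1ℤ mod p²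
  shifted-inverse {i} i<s = to-p² (mod-trans
    (mod-reflexive (cong (ℤ._* shifted j) (trans (α-eq (+ suc i)) (trans (cong (λ z → 1ℤ ℤ.+ (z ℤ.+ t ℤ.* p) ℤ.- + suc i) s≡)
      (lemma (+ i) (+ j) (t ℤ.* p))))))
    (linear₂ (1ℤ ℤ.- t ℤ.* p ℤ.* inv j) (ℤ.- (t ℤ.* t ℤ.* (inv j ℤ.* inv j)))
      (from-p² (inv-law (ℕ.<-≤-trans j<s s≤N))) (∣⇒≡0 (∣-refl {p ℤ.* p})) (lemma′ (+ suc j) (inv j) t p)))
    where
    j : ℕ
    j = s ∸ suc i

    j<s : j < s
    j<s = ℕ.∸-monoʳ-< (s≤s z≤n) i<s

    s≡ : + s ≡ + suc i ℤ.+ + j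
    s≡ = cong +_ (sym (ℕ.m+[n∸m]≡n i<s))

    lemma : ∀ i j q → 1ℤ ℤ.+ (1ℤ ℤ.+ i ℤ.+ j ℤ.+ q) ℤ.- (1ℤ ℤ.+ i) ≡ 1ℤ ℤ.+ j ℤ.+ q
    lemma = solve-∀
    lemma′ : ∀ j i t p → (j ℤ.+ t ℤ.* p) ℤ.* (i ℤ.- t ℤ.* p ℤ.* (i ℤ.* i)) ℤ.- 1ℤ ≡
      (1ℤ ℤ.- t ℤ.* p ℤ.* i) ℤ.* (j ℤ.* i ℤ.- 1ℤ) ℤ.+ ℤ.- (t ℤ.* t ℤ.* (i ℤ.* i)) ℤ.* (p ℤ.* p ℤ.- 0ℤ)
    lemma′ = solve-∀

  ∑-shifted : ∀ n → ∑ n shifted ≡ h n ℤ.- t ℤ.* p ℤ.* h₂ n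
  ∑-shifted zero    = lemma (t ℤ.* p)
    where
    lemma : ∀ q → 0ℤ ≡ 0ℤ ℤ.- q ℤ.* 0ℤ
    lemma = solve-∀
  ∑-shifted (suc n) = trans (cong (ℤ._+ shifted n) (∑-shifted n)) (lemma (h n) (h₂ n) (inv n) (t ℤ.* p))
    where
    lemma : ∀ h h₂ i q → h ℤ.- q ℤ.* h₂ ℤ.+ (i ℤ.- q ℤ.* (i ℤ.* i)) ≡ h ℤ.+ i ℤ.- q ℤ.* (h₂ ℤ.+ i ℤ.* i)
    lemma = solve-∀

  module _ (r : ℕ) (r-s : r ≡ suc s ⊎ (r ≡ 0 × s ≡ N)) where

    first : S (suc N) (α ℤ.- 1ℤ) ≡ sgn ℤ.∣ + r ℤ.- 1ℤ ∣ ℤ.* (+ 2 ℤ.* ∑ (r ∸ 1) (λ i → shifted (s ∸ suc i))) mod p²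
    first = to-p² (mod-trans S≡ (goal r-s))
      where
      goal : r ≡ suc s ⊎ (r ≡ 0 × s ≡ N) →
        sgn s ℤ.* (+ 2 ℤ.* (h s ℤ.- t ℤ.* p ℤ.* h₂ s)) ≡
        sgn ℤ.∣ + r ℤ.- 1ℤ ∣ ℤ.* (+ 2 ℤ.* ∑ (r ∸ 1) (λ i → shifted (s ∸ suc i))) mod (p ℤ.* p)
      goal (inj₁ refl)          = mod-reflexive (cong (λ z → sgn s ℤ.* (+ 2 ℤ.* z)) (sym (trans (∑-reverse s shifted) (∑-shifted s))))
      goal (inj₂ (refl , refl)) = linear₂ (sgn N ℤ.* + 2) (ℤ.- (sgn N ℤ.* + 2 ℤ.* t)) hN≡0 ph₂N≡0
        (lemma (sgn N) (h N) (h₂ N) t p)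
        where
        lemma : ∀ σ h h₂ t p → σ ℤ.* (+ 2 ℤ.* (h ℤ.- t ℤ.* p ℤ.* h₂)) ℤ.- ℤ.- 1ℤ ℤ.* (+ 2 ℤ.* 0ℤ) ≡
          (σ ℤ.* + 2) ℤ.* (h ℤ.- 0ℤ) ℤ.+ ℤ.- (σ ℤ.* + 2 ℤ.* t) ℤ.* (p ℤ.* h₂ ℤ.- 0ℤ)
        lemma = solve-∀

    second : S (suc N) (α ℤ.- 1ℤ) ≡ sgn s ℤ.* (+ 2 ℤ.* h s ℤ.+ (α ℤ.- + r) ℤ.* β (2 ℕ.+ l)) mod p²
    second = to-p² (mod-trans S≡ (goal r-s))
      where
      goal : r ≡ suc s ⊎ (r ≡ 0 × s ≡ N) →
        sgn s ℤ.* (+ 2 ℤ.* (h s ℤ.- t ℤ.* p ℤ.* h₂ s)) ≡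
        sgn s ℤ.* (+ 2 ℤ.* h s ℤ.+ (α ℤ.- + r) ℤ.* β (2 ℕ.+ l)) mod (p ℤ.* p)
      goal (inj₁ refl) = linear₁ (ℤ.- (sgn s ℤ.* t)) pβ≡
        (trans (cong (λ z → left ℤ.- sgn s ℤ.* (+ 2 ℤ.* h s ℤ.+ z ℤ.* β (2 ℕ.+ l))) (α-eq (+ suc s)))
          (lemma (sgn s) (h s) (h₂ s) t p (β (2 ℕ.+ l)) (+ s)))
        where
        left : ℤ
        left = sgn s ℤ.* (+ 2 ℤ.* (h s ℤ.- t ℤ.* p ℤ.* h₂ s))
        lemma : ∀ σ h h₂ t p β s →
          σ ℤ.* (+ 2 ℤ.* (h ℤ.- t ℤ.* p ℤ.* h₂))
            ℤ.- σ ℤ.* (+ 2 ℤ.* h ℤ.+ (1ℤ ℤ.+ (s ℤ.+ t ℤ.* p) ℤ.- (1ℤ ℤ.+ s)) ℤ.* β) ≡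
          ℤ.- (σ ℤ.* t) ℤ.* (p ℤ.* β ℤ.- p ℤ.* (ℤ.- + 2 ℤ.* h₂))
        lemma = solve-∀
      goal (inj₂ (refl , refl)) = linear₂ (ℤ.- (sgn N ℤ.* (1ℤ ℤ.+ t))) (sgn N ℤ.* + 2) pβ≡ ph₂N≡0
        (trans (cong (λ z → left ℤ.- sgn N ℤ.* (+ 2 ℤ.* h N ℤ.+ z ℤ.* β (2 ℕ.+ l))) (α-eq 0ℤ))
          (lemma (sgn N) (h N) (h₂ N) t (+ N) (β (2 ℕ.+ l))))
        where
        left : ℤ
        left = sgn N ℤ.* (+ 2 ℤ.* (h N ℤ.- t ℤ.* p ℤ.* h₂ N))
        lemma : ∀ σ h h₂ t n β →
          σ ℤ.* (+ 2 ℤ.* (h ℤ.- t ℤ.* (1ℤ ℤ.+ n) ℤ.* h₂))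
            ℤ.- σ ℤ.* (+ 2 ℤ.* h ℤ.+ (1ℤ ℤ.+ (n ℤ.+ t ℤ.* (1ℤ ℤ.+ n)) ℤ.- 0ℤ) ℤ.* β) ≡
          ℤ.- (σ ℤ.* (1ℤ ℤ.+ t)) ℤ.* ((1ℤ ℤ.+ n) ℤ.* β ℤ.- (1ℤ ℤ.+ n) ℤ.* (ℤ.- + 2 ℤ.* h₂))
            ℤ.+ (σ ℤ.* + 2) ℤ.* ((1ℤ ℤ.+ n) ℤ.* h₂ ℤ.- 0ℤ)
        lemma = solve-∀

    third : S (suc N) (α ℤ.- 1ℤ) ≡ sgn r ℤ.* (+ 2 ℤ.* β N) mod p
    third = mod-trans (mod-trans (mod-weaken (∣m⇒∣m*n p ∣-refl) S≡) S≡′) (goal r-s)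
      where
      S≡′ : sgn s ℤ.* (+ 2 ℤ.* (h s ℤ.- t ℤ.* p ℤ.* h₂ s)) ≡ sgn s ℤ.* (+ 2 ℤ.* h s) mod p
      S≡′ = ∣⇒mod (divides (ℤ.- (sgn s ℤ.* + 2 ℤ.* t ℤ.* h₂ s)) (lemma (sgn s) (h s) (h₂ s) t p))
        where
        lemma : ∀ σ h h₂ t p → σ ℤ.* (+ 2 ℤ.* (h ℤ.- t ℤ.* p ℤ.* h₂)) ℤ.- σ ℤ.* (+ 2 ℤ.* h) ≡
          ℤ.- (σ ℤ.* + 2 ℤ.* t ℤ.* h₂) ℤ.* p
        lemma = solve-∀

      goal : r ≡ suc s ⊎ (r ≡ 0 × s ≡ N) → sgn s ℤ.* (+ 2 ℤ.* h s) ≡ sgn r ℤ.* (+ 2 ℤ.* β N) mod p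
      goal (inj₁ refl) = linear₁ (sgn s ℤ.* + 2) β-last (lemma (sgn s) (h s) (β N))
        where
        lemma : ∀ σ h β → σ ℤ.* (+ 2 ℤ.* h) ℤ.- ℤ.- σ ℤ.* (+ 2 ℤ.* β) ≡ (σ ℤ.* + 2) ℤ.* (β ℤ.- ℤ.- h)
        lemma = solve-∀
      goal (inj₂ (refl , refl)) = linear₂ (ℤ.- + 2) (sgn N ℤ.* + 2 ℤ.+ + 2) β-last (mod-weaken (∣m⇒∣m*n p ∣-refl) hN≡0)
        (lemma (sgn N) (h N) (β N))
        where
        lemma : ∀ σ h β → σ ℤ.* (+ 2 ℤ.* h) ℤ.- 1ℤ ℤ.* (+ 2 ℤ.* β) ≡
          ℤ.- + 2 ℤ.* (β ℤ.- ℤ.- h) ℤ.+ (σ ℤ.* + 2 ℤ.+ + 2) ℤ.* (h ℤ.- 0ℤ)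
        lemma = solve-∀

congruences : ∀ p (p-prime : Prime p) → 3 < p → (let open Residues p p-prime) (let open Terms p p-prime) (let open Padic p p-prime using (p^)) →
  (b : ℕ → ℤ) → b 0 ≡ 1ℤ mod (p^ 2) →
  (∀ {n} → 0 < n → n < p ∸ 1 → ∑ (suc n) (λ k → + (suc n C k) ℤ.* b k) ≡ 0ℤ mod (p^ 2)) →
  b (p ∸ 1) ≡ 0ℤ →
  ∀ α {r s} → r < p → s < p → α ≡ + r mod (+ p) → α ℤ.- 1ℤ ≡ + s mod (+ p) →
  let open Harmonic inv in
  ∃ λ g → (∀ {i} → suc i < r → (α ℤ.- + suc i) ℤ.* g i ≡ 1ℤ mod (p^ 2))
    × S p (α ℤ.- 1ℤ) ≡ sgn ℤ.∣ + r ℤ.- 1ℤ ∣ ℤ.* (+ 2 ℤ.* ∑ (r ∸ 1) g) mod (p^ 2)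
    × S p (α ℤ.- 1ℤ) ≡ sgn s ℤ.* (+ 2 ℤ.* h s ℤ.+ (α ℤ.- + r) ℤ.* (b ⋆ pow α) (p ∸ 2)) mod (p^ 2)
    × S p (α ℤ.- 1ℤ) ≡ sgn r ℤ.* (+ 2 ℤ.* (b ⋆ pow α) (p ∸ 1)) mod (p^ 1)
congruences p@(suc N@(suc (suc (suc l)))) p-prime (s≤s (s≤s (s≤s (s≤s z≤n)))) b b-zero b-rec b-last α {r} {s} r<p (s≤s s≤N) α≡r (∣⇒mod (divides t eq)) =
  (λ i → shifted (s ∸ suc i)) , inverse r-s , first r r-s , second r r-s ,
  subst (S p (α ℤ.- 1ℤ) ≡ sgn r ℤ.* (+ 2 ℤ.* (b ⋆ pow α) N) mod_) (sym (cong +_ (ℕ.*-identityʳ p))) (third r r-s)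
  where
  open Terms p p-prime
  open Harmonic inv

  α-1≡ : α ℤ.- 1ℤ ≡ + s ℤ.+ t ℤ.* + p
  α-1≡ = trans (lemma (α ℤ.- 1ℤ) (+ s)) (cong (λ z → + s ℤ.+ z) eq)
    where
    lemma : ∀ x s → x ≡ s ℤ.+ (x ℤ.- s)
    lemma = solve-∀

  open Congruences l p-prime inv (λ k<N → inv-law (s≤s k<N)) b b-zero b-rec b-last α s s≤N t α-1≡

  r≡1+s : + r ≡ + suc s mod (+ p)
  r≡1+s = linear₂ (ℤ.- 1ℤ) 1ℤ α≡r (∣⇒mod {α ℤ.- 1ℤ} {+ s} (divides t eq)) (lemma α (+ r) (+ s))
    where
    lemma : ∀ α r s → r ℤ.- (1ℤ ℤ.+ s) ≡ ℤ.- 1ℤ ℤ.* (α ℤ.- r) ℤ.+ 1ℤ ℤ.* (α ℤ.- 1ℤ ℤ.- s)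
    lemma = solve-∀

  r-s : r ≡ suc s ⊎ (r ≡ 0 × s ≡ N)
  r-s with ℕ.m≤n⇒m<n∨m≡n s≤N
  ... | inj₁ s<N  = inj₁ (<-residue-unique r<p (s≤s s<N) r≡1+s)
  ... | inj₂ refl = inj₂ (<-residue-unique r<p (s≤s z≤n) (mod-trans r≡1+s (∣⇒≡0 ∣-refl)) , refl)

  inverse : r ≡ suc s ⊎ (r ≡ 0 × s ≡ N) → ∀ {i} → suc i < r → (α ℤ.- + suc i) ℤ.* shifted (s ∸ suc i) ≡ 1ℤ mod (+ (p ℕ.^ 2))
  inverse (inj₁ refl) (s≤s i<s) = shifted-inverse i<s

module Proof (p : ℕ) (p-prime : Prime p) (3<p : 3 < p) (a : Padic.ℤₚ p p-prime) where

  open Padic p p-prime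
  open Residues p p-prime
  open Terms p p-prime

  private
    instance
      p≢0 : ℕ.NonZero p
      p≢0 = prime⇒nonZero p-prime

  α : ℤ
  α = a at 2

  p∸1<p : p ∸ 1 < p
  p∸1<p = ℕ.∸-monoʳ-< (s≤s z≤n) (ℕ.≤-trans (s≤s z≤n) 3<p)

  p∸1≡ : p ∸ 1 ≡ suc (p ∸ 2)
  p∸1≡ = ℕ.+-∸-assoc 1 {p} {2} (ℕ.≤-trans (s≤s (s≤s z≤n)) 3<p)

  0<p∸1 : 0 < p ∸ 1
  0<p∸1 = subst (0 <_) (sym p∸1≡) (s≤s z≤n)

  suc<p∸1 : ∀ {k} → k < p ∸ 2 → suc k < p ∸ 1
  suc<p∸1 {k} k< = subst (suc k <_) (sym p∸1≡) (s≤s k<)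

  open BernoulliResidues (p ∸ 1) p∸1<p

  at-2 : ∀ x → x at 2 ≡ + (x at 1 %ℕ p) mod (+ p)
  at-2 x = mod-trans (subst (x at 2 ≡ x at 1 mod_) p^1≡p (at-coherent x 1 1)) (%ℕ-residue (x at 1) p)

  residues = congruences p p-prime 3<p b (b-zero 0<p∸1) b-recurrence (b-above ℕ.≤-refl) α
    (n%ℕd<d (a at 1) p) (n%ℕd<d ((a -ᶻ 1ᶻ) at 1) p) (at-2 a) (at-2 (a -ᶻ 1ᶻ))

  combine : ∀ {ν δ ν₁ δ₁ ν₂ δ₂ ν₃ δ₃ i i₁ i₂ i₃} →
    Residue ν δ i → Residue ν₁ δ₁ i₁ → Residue ν₂ δ₂ i₂ → Residue ν₃ δ₃ i₃ →
    i ≡ i₁ mod (p^ 2) × i ≡ i₂ mod (p^ 2) × i ≡ i₃ mod (p^ 1) →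
    Congruent ν δ ν₁ δ₁ 2 × Congruent ν δ ν₂ δ₂ 2 × Congruent ν δ ν₃ δ₃ 1
  combine e e₁ e₂ e₃ (c₁ , c₂ , c₃) =
    ∼⇒congruent 2 ℕ.≤-refl e e₁ c₁ , ∼⇒congruent 2 ℕ.≤-refl e e₂ c₂ , ∼⇒congruent 1 (s≤s z≤n) e e₃ c₃

theorem1p1 :
  (p : ℕ) (p-prime : Prime p) → 3 < p →
  let open Padic p p-prime in
  (a : ℤₚ) →
  let S = ∑[ k < p ] binom (ι (-ᶻ a)) k * binom (ι (a -ᶻ 1ᶻ)) k * fromℚ (H k)
      r = ⟨ a ⟩
      s = ⟨ a -ᶻ 1ᶻ ⟩
  in
  (S ≡ -1^ (+ r ℤ.- 1ℤ) * (2ₚ * (∑[0< k < r by k<r ] 1/ (a -ᶻ fromℤ (+ k)) (shift-#0 a k<r))) mod-p^ 2)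
  × (S ≡ -1^ (+ s) * (2ₚ * fromℚ (H s) + ι (a -ᶻ fromℤ (+ r)) * Bₚ (p ∸ 2) (ι a)) mod-p^ 2)
  × (S ≡ -1^ (+ r) * (2ₚ * (Bₚ (p ∸ 1) (ι a) - fromℚ (B (p ∸ 1)))) mod-p^ 1)
theorem1p1 p p-prime 3<p a = combine
  (∼-sum p (λ i → ∼-summand α (toℕ i) (toℕ<n i) (λ j → factor (-ᶻ a) (toℕ j)) (λ j → factor (a -ᶻ 1ᶻ) (toℕ j))))
  (∼-* (∼-sign ℤ.∣ + ⟨ a ⟩ ℤ.- 1ℤ ∣ (∼-neg (∼-ι 1ᶻ)))
    (∼-* (∼-ι (fromℤ (+ 2))) (∼-sum-0< ⟨ a ⟩ (λ i i<r → ∼-1/ (a -ᶻ fromℤ (+ suc i)) (proj₂ (shift-#0 a i<r)) (proj₁ (proj₂ residues) i<r)))))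
  (∼-* (∼-sign ⟨ a -ᶻ 1ᶻ ⟩ (∼-neg (∼-ι 1ᶻ)))
    (∼-+ (∼-* (∼-ι (fromℤ (+ 2))) (∼-H (n%ℕd<d ((a -ᶻ 1ᶻ) at 1) p)))
      (∼-* (∼-ι (a -ᶻ fromℤ (+ ⟨ a ⟩)))
        (∼-Bₚ α (p ∸ 2) (∼-Bₚ-term (p ∸ 2) {0} 0<p∸1 (∼-ι a)) (∼-sum (p ∸ 2) (λ i → ∼-Bₚ-term (p ∸ 2) {suc (toℕ i)} (suc<p∸1 (toℕ<n i)) (∼-ι a)))))))
  (∼-* (∼-sign ⟨ a ⟩ (∼-neg (∼-ι 1ᶻ)))
    (∼-* (∼-ι (fromℤ (+ 2)))
      (∼-Bₚ-diff α (p ∸ 2) p∸1≡ (∼-Bₚ-term (p ∸ 1) {0} 0<p∸1 (∼-ι a)) (λ i i≡ → ∼-Bₚ-last-term (trans (cong suc i≡) (sym p∸1≡)))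
        (λ i i< → ∼-Bₚ-term (p ∸ 1) {suc (toℕ i)} (suc<p∸1 i<) (∼-ι a)))))
  (proj₂ (proj₂ residues))
  where
  open Padic p p-prime
  open Residues p p-prime
  open Terms p p-prime
  open Proof p p-prime 3<p a
  open BernoulliResidues (p ∸ 1) p∸1<p

  instance
    p≢0 : ℕ.NonZero p
    p≢0 = prime⇒nonZero p-prime

  factor : ∀ x j → Residue (λ n → x at n ℤ.* 1ℤ ℤ.+ ℤ.- + j ℤ.* 1ℤ) (λ _ → 1ℤ ℤ.* 1ℤ) (x at 2 ℤ.- + j)
  factor x j = ∼-+ (∼-ι x) (∼-neg (∼-ι (fromℤ (+ j))))
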